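{- Let $p$ be a prime, $m\in\mathbb{N}$ with $m\ge 1$, $n=p^m$, and $S=\{a\in\mathbb{Z}_n \mid \gcd(a,n)=1\}$. Then the adjacency spectrum of the Cayley graph $\Gamma=\mathrm{Cay}(\mathbb{Z}_n,S)$ is $$\{\,n-p^{m-1},\ 0^{(n-p)},\ (-p^{m-1})^{(p-1)}\,\}.$$
   Context: For a finite group $G$ and an inverse-closed subset $H\subseteq G$ not containing the identity, $\mathrm{Cay}(G,H)$ is the simple undirected graph with vertex set $G$ in which $x,y$ are adjacent iff $x^{ -1}y\in H$. Here $G=\mathbb{Z}_n$ is the additive cyclic group, so $x,y$ are adjacent iff $y-x\in S$. The adjacency spectrum is the multiset of eigenvalues of the adjacency matrix; a superscript in parentheses denotes the multiplicity (no superscript means multiplicity one; multiplicity $0$ means the value does not occur). -}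

module Defs where

open import Algebra.Bundles.Raw using (RawRing)
open import Algebra.Structures using (IsGroup)
import Algebra.Definitions.RawSemiring as RawSemiringDefs
open import Data.Bool.Base using (if_then_else_)
open import Data.Fin.Base using (Fin; zero; suc; toℕ; punchIn)
open import Data.Fin.Properties using (toℕ-injective; toℕ-fromℕ<; toℕ<n; toℕ≤n) renaming (_≟_ to _≟ᶠ_)
open import Data.Integer.Base as ℤ using (ℤ; 0ℤ; 1ℤ; -_)
open import Data.List.Base using (List; []; _∷_; foldr; map)
open import Data.Nat.Base as ℕ using (ℕ; zero; suc; _+_; _∸_; _^_; _≥_; s≤s; NonZero; NonTrivial)
open import Data.Nat.Divisibility using (_∣_; ∣1⇒≡1; ∣m+n∣m⇒∣n; ∣n∣m%n⇒∣m)
open import Data.Nat.DivMod using (_%_; _mod_; m%n<n; m<n⇒m%n≡m; n%n≡0; m%n%n≡m%n; %-distribˡ-+)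
open import Data.Nat.GCD using (gcd; gcd[m,n]∣m; gcd[m,n]∣n; gcd-greatest; gcd-identityˡ)
open import Data.Nat.Primality using (Prime; prime⇒nonZero; prime⇒nonTrivial)
import Data.Nat.Properties as ℕₚ
open import Data.Product.Base using (_,_)
open import Level using (0ℓ)
open import Relation.Binary.Core using (Rel)
import Relation.Binary.Definitions as B
open import Relation.Binary.PropositionalEquality using (_≡_; refl; sym; trans; cong; cong₂; subst; isEquivalence; module ≡-Reasoning)
open import Relation.Nullary using (¬_; does)
open import Relation.Unary using (Pred)
import Relation.Unary as U

------------------------------------------------------------------------
-- Matrices and determinants

Matrix : Set → ℕ → Set
Matrix A n = Fin n → Fin n → A

module Determinant (R : RawRing 0ℓ 0ℓ) where
  open RawRing R using (Carrier; rawSemiring; 1#) renaming (_*_ to _·_; -_ to neg)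
  open RawSemiringDefs rawSemiring using (sum) renaming (_^_ to _^ᴿ_)

  minor : ∀ {n} → Matrix Carrier (suc n) → Fin (suc n) → Matrix Carrier n
  minor M j i k = M (suc i) (punchIn j k)

  -- Laplace expansion along the first row.
  det : ∀ {n} → Matrix Carrier n → Carrier
  det {zero}  M = 1#
  det {suc n} M = sum λ j → ((neg 1#) ^ᴿ toℕ j) · (M zero j · det (minor M j))

------------------------------------------------------------------------
-- The polynomial ring ℤ[X]

-- Coefficients, constant term first. Trailing zeros are allowed, so
-- equality of polynomials is _≈ᴾ_ and not _≡_.
Poly : Set
Poly = List ℤ

coeff : Poly → ℕ → ℤ
coeff []      _       = 0ℤ
coeff (a ∷ _) zero    = a
coeff (_ ∷ p) (suc k) = coeff p k

infix 4 _≈ᴾ_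
_≈ᴾ_ : Rel Poly 0ℓ
p ≈ᴾ q = ∀ k → coeff p k ≡ coeff q k

const : ℤ → Poly
const a = a ∷ []

X : Poly
X = 0ℤ ∷ 1ℤ ∷ []

infixl 6 _+ᴾ_ _-ᴾ_
infixl 7 _*ᴾ_

_+ᴾ_ : Poly → Poly → Poly
[]      +ᴾ q       = q
(a ∷ p) +ᴾ []      = a ∷ p
(a ∷ p) +ᴾ (b ∷ q) = (a ℤ.+ b) ∷ (p +ᴾ q)

-ᴾ_ : Poly → Poly
-ᴾ_ = map -_

_-ᴾ_ : Poly → Poly → Poly
p -ᴾ q = p +ᴾ (-ᴾ q)

_*ᴾ_ : Poly → Poly → Poly
[]      *ᴾ q = []
(a ∷ p) *ᴾ q = map (a ℤ.*_) q +ᴾ (0ℤ ∷ (p *ᴾ q))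

ℤ[X] : RawRing 0ℓ 0ℓ
ℤ[X] = record
  { Carrier = Poly
  ; _≈_     = _≈ᴾ_
  ; _+_     = _+ᴾ_
  ; _*_     = _*ᴾ_
  ; -_      = -ᴾ_
  ; 0#      = const 0ℤ
  ; 1#      = const 1ℤ
  }

------------------------------------------------------------------------
-- Spectra of integer matrices

charPoly : ∀ {n} → Matrix ℤ n → Poly
charPoly A = Determinant.det ℤ[X] λ i j →
  (if does (i ≟ᶠ j) then X else const 0ℤ) -ᴾ const (A i j)

-- A multiset of integers is represented by a list (in any order). It is
-- the multiset of all eigenvalues of A, counted with multiplicity, when it
-- is the multiset of roots of det (X·I − A). As the factorisation into
-- linear factors is complete, A has no further real or complex eigenvalue.
HasSpectrum : ∀ {n} → Matrix ℤ n → List ℤ → Set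
HasSpectrum A θs = charPoly A ≈ᴾ foldr (λ θ q → (X -ᴾ const θ) *ᴾ q) (const 1ℤ) θs

------------------------------------------------------------------------
-- Graphs

record SimpleGraph (n : ℕ) : Set₁ where
  field
    Adj    : Rel (Fin n) 0ℓ
    adj?   : B.Decidable Adj
    symm   : B.Symmetric Adj
    irrefl : ∀ x → ¬ Adj x x

adjacencyMatrix : ∀ {n} → SimpleGraph n → Matrix ℤ n
adjacencyMatrix Γ x y = if does (SimpleGraph.adj? Γ x y) then 1ℤ else 0ℤ

HasAdjacencySpectrum : ∀ {n} → SimpleGraph n → List ℤ → Set
HasAdjacencySpectrum Γ = HasSpectrum (adjacencyMatrix Γ)

------------------------------------------------------------------------
-- Cayley graphs

-- A group of order n, its elements being labelled by Fin n.
record FiniteGroup (n : ℕ) : Set where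
  infixl 7 _∙_
  infix  8 _⁻¹
  field
    _∙_     : Fin n → Fin n → Fin n
    ε       : Fin n
    _⁻¹     : Fin n → Fin n
    isGroup : IsGroup _≡_ _∙_ ε _⁻¹

  open IsGroup isGroup public using (assoc; identityˡ; identityʳ; inverseˡ; inverseʳ)

record ConnectionSet {n : ℕ} (G : FiniteGroup n) : Set₁ where
  open FiniteGroup G
  field
    Member        : Pred (Fin n) 0ℓ
    member?       : U.Decidable Member
    inverseClosed : ∀ {a} → Member a → Member (a ⁻¹)
    ε∉            : ¬ Member ε

module _ {n : ℕ} (G : FiniteGroup n) where
  open FiniteGroup G

  private
    [x⁻¹y]⁻¹≡y⁻¹x : ∀ x y → (x ⁻¹ ∙ y) ⁻¹ ≡ y ⁻¹ ∙ x
    [x⁻¹y]⁻¹≡y⁻¹x x y = begin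
      a ⁻¹                  ≡⟨ sym (identityʳ (a ⁻¹)) ⟩
      a ⁻¹ ∙ ε              ≡⟨ cong (a ⁻¹ ∙_) (sym ab≡ε) ⟩
      a ⁻¹ ∙ (a ∙ b)        ≡⟨ sym (assoc (a ⁻¹) a b) ⟩
      a ⁻¹ ∙ a ∙ b          ≡⟨ cong (_∙ b) (inverseˡ a) ⟩
      ε ∙ b                 ≡⟨ identityˡ b ⟩
      b                     ∎
      where
      open ≡-Reasoning
      a = x ⁻¹ ∙ y
      b = y ⁻¹ ∙ x
      ab≡ε : a ∙ b ≡ ε
      ab≡ε = begin
        x ⁻¹ ∙ y ∙ (y ⁻¹ ∙ x)   ≡⟨ assoc (x ⁻¹) y b ⟩
        x ⁻¹ ∙ (y ∙ (y ⁻¹ ∙ x)) ≡⟨ cong (x ⁻¹ ∙_) (sym (assoc y (y ⁻¹) x)) ⟩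
        x ⁻¹ ∙ (y ∙ y ⁻¹ ∙ x)   ≡⟨ cong (λ z → x ⁻¹ ∙ (z ∙ x)) (inverseʳ y) ⟩
        x ⁻¹ ∙ (ε ∙ x)          ≡⟨ cong (x ⁻¹ ∙_) (identityˡ x) ⟩
        x ⁻¹ ∙ x                ≡⟨ inverseˡ x ⟩
        ε                       ∎

  Cay : ConnectionSet G → SimpleGraph n
  Cay H = record
    { Adj    = λ x y → Member (x ⁻¹ ∙ y)
    ; adj?   = λ x y → member? (x ⁻¹ ∙ y)
    ; symm   = λ {x} {y} h → subst Member ([x⁻¹y]⁻¹≡y⁻¹x x y) (inverseClosed h)
    ; irrefl = λ x h → ε∉ (subst Member (inverseˡ x) h)
    }
    where open ConnectionSet H

------------------------------------------------------------------------
-- The additive group ℤₙ of residues 0, …, n − 1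

module _ (n : ℕ) .{{_ : NonZero n}} where

  add : Fin n → Fin n → Fin n
  add i j = (toℕ i + toℕ j) mod n

  negate : Fin n → Fin n
  negate i = (n ∸ toℕ i) mod n

  private
    toℕ-mod : ∀ a → toℕ (a mod n) ≡ a % n
    toℕ-mod a = toℕ-fromℕ< (m%n<n a n)

    toℕ-% : ∀ (i : Fin n) → toℕ i % n ≡ toℕ i
    toℕ-% i = m<n⇒m%n≡m (toℕ<n i)

    0%n≡0 : 0 % n ≡ 0
    0%n≡0 = m<n⇒m%n≡m (ℕₚ.n≢0⇒n>0 (ℕ.≢-nonZero⁻¹ n))

    [a%n+b]%n : ∀ a b → (a % n + b) % n ≡ (a + b) % n
    [a%n+b]%n a b = begin
      (a % n + b) % n         ≡⟨ %-distribˡ-+ (a % n) b n ⟩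
      (a % n % n + b % n) % n ≡⟨ cong (λ z → (z + b % n) % n) (m%n%n≡m%n a n) ⟩
      (a % n + b % n) % n     ≡⟨ sym (%-distribˡ-+ a b n) ⟩
      (a + b) % n             ∎
      where open ≡-Reasoning

    add-comm : ∀ i j → add i j ≡ add j i
    add-comm i j = cong (_mod n) (ℕₚ.+-comm (toℕ i) (toℕ j))

    add-mod : ∀ a j → toℕ (add (a mod n) j) ≡ (a + toℕ j) % n
    add-mod a j = begin
      toℕ (add (a mod n) j)        ≡⟨ toℕ-mod _ ⟩
      (toℕ (a mod n) + toℕ j) % n  ≡⟨ cong (λ z → (z + toℕ j) % n) (toℕ-mod a) ⟩
      (a % n + toℕ j) % n          ≡⟨ [a%n+b]%n a (toℕ j) ⟩
      (a + toℕ j) % n              ∎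
      where open ≡-Reasoning

    add-assoc : ∀ i j k → add (add i j) k ≡ add i (add j k)
    add-assoc i j k = toℕ-injective (begin
      toℕ (add (add i j) k)           ≡⟨ add-mod (toℕ i + toℕ j) k ⟩
      (toℕ i + toℕ j + toℕ k) % n     ≡⟨ cong (_% n) (ℕₚ.+-assoc (toℕ i) (toℕ j) (toℕ k)) ⟩
      (toℕ i + (toℕ j + toℕ k)) % n   ≡⟨ cong (_% n) (ℕₚ.+-comm (toℕ i) _) ⟩
      (toℕ j + toℕ k + toℕ i) % n     ≡⟨ sym (add-mod (toℕ j + toℕ k) i) ⟩
      toℕ (add (add j k) i)           ≡⟨ cong toℕ (add-comm (add j k) i) ⟩
      toℕ (add i (add j k))           ∎)
      where open ≡-Reasoning

    add-identityˡ : ∀ i → add (0 mod n) i ≡ i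
    add-identityˡ i = toℕ-injective (trans (add-mod 0 i) (toℕ-% i))

    add-inverseˡ : ∀ i → add (negate i) i ≡ 0 mod n
    add-inverseˡ i = toℕ-injective (begin
      toℕ (add (negate i) i)     ≡⟨ add-mod (n ∸ toℕ i) i ⟩
      (n ∸ toℕ i + toℕ i) % n    ≡⟨ cong (_% n) (ℕₚ.m∸n+n≡m (toℕ≤n i)) ⟩
      n % n                      ≡⟨ n%n≡0 n ⟩
      0                          ≡⟨ sym 0%n≡0 ⟩
      0 % n                      ≡⟨ sym (toℕ-mod 0) ⟩
      toℕ (0 mod n)              ∎)
      where open ≡-Reasoning

  ℤₙ : FiniteGroup n
  ℤₙ = record
    { _∙_     = add
    ; ε       = 0 mod n
    ; _⁻¹     = negate
    ; isGroup = record
      { isMonoid = record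
        { isSemigroup = record
          { isMagma = record { isEquivalence = isEquivalence ; ∙-cong = cong₂ add }
          ; assoc   = add-assoc
          }
        ; identity = add-identityˡ , λ i → trans (add-comm i _) (add-identityˡ i)
        }
      ; inverse = add-inverseˡ , λ i → trans (add-comm i _) (add-inverseˡ i)
      ; ⁻¹-cong = cong negate
      }
    }

  private
    coprime-negate : ∀ (a : Fin n) → gcd (toℕ a) n ≡ 1 → gcd (toℕ (negate a)) n ≡ 1
    coprime-negate a gcd≡1 = ∣1⇒≡1 (subst (d ∣_) gcd≡1 (gcd-greatest d∣a d∣n))
      where
      d = gcd (toℕ (negate a)) n
      d∣n : d ∣ n
      d∣n = gcd[m,n]∣n (toℕ (negate a)) n
      d∣n∸a : d ∣ n ∸ toℕ a
      d∣n∸a = ∣n∣m%n⇒∣m d∣n (subst (d ∣_) (toℕ-mod (n ∸ toℕ a)) (gcd[m,n]∣m (toℕ (negate a)) n))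
      d∣a : d ∣ toℕ a
      d∣a = ∣m+n∣m⇒∣n (subst (d ∣_) (sym (ℕₚ.m∸n+n≡m (toℕ≤n a))) d∣n) d∣n∸a

    gcd[0,n]≡n : gcd (toℕ (0 mod n)) n ≡ n
    gcd[0,n]≡n = trans (cong (λ z → gcd z n) (trans (toℕ-mod 0) 0%n≡0)) (gcd-identityˡ n)

  -- {a ∈ ℤₙ ∣ gcd(a, n) = 1}. For n = 1 it would contain the identity.
  coprimeResidues : .{{NonTrivial n}} → ConnectionSet ℤₙ
  coprimeResidues = record
    { Member        = λ a → gcd (toℕ a) n ≡ 1
    ; member?       = λ a → gcd (toℕ a) n ℕₚ.≟ 1
    ; inverseClosed = λ {a} → coprime-negate a
    ; ε∉            = λ gcd≡1 → ℕ.nonTrivial⇒≢1 (trans (sym gcd[0,n]≡n) gcd≡1)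
    }

primePower-nonZero : ∀ {p} → Prime p → ∀ m → NonZero (p ^ m)
primePower-nonZero {p} p-prime m = ℕₚ.m^n≢0 p m {{prime⇒nonZero p-prime}}

primePower-nonTrivial : ∀ {p} → Prime p → ∀ {m} → m ≥ 1 → NonTrivial (p ^ m)
primePower-nonTrivial {p} p-prime {suc m} (s≤s _) =
  ℕₚ.n≢0∧m>1⇒m*n>1 p (p ^ m) {{primePower-nonZero p-prime m}} {{prime⇒nonTrivial p-prime}}

{-# OPTIONS --safe #-}

-- Two residues are adjacent exactly when they differ modulo p, so Γ is the
-- complete p-partite graph whose parts are the residue classes mod p, each of
-- size q = p^(m-1). Let x̄ be the least element of the class of x. In X·I − A:
--   * subtracting row x̄ from row x ≥ p leaves X·(e_x − e_x̄), which yields the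
--     factor X^(n-p);
--   * with the rows e_x − e_x̄ the columns ≥ p of the first p rows are cleared,
--     and the remaining p × p block is (X + q)·I − q·J;
--   * subtracting row 0 from the other rows of that block leaves
--     (X + q)·(e_y − e_0), which yields (X + q)^(p-1), and with the rows
--     e_y − e_0 row 0 is cleared to (X + q − pq)·e_0.
-- What is left is lower triangular, and X + q − pq = X − (n − q).

module Submission where

open import Defs
open import Algebra.Bundles using (CommutativeRing; Monoid; Semiring)
import Algebra.Definitions.RawSemiring as RawSemiringDefs
import Algebra.Properties.Monoid.Sum as MonoidSum
import Algebra.Properties.Ring as RingProperties
import Algebra.Properties.Semiring.Sum as SemiringSum
import Algebra.Solver.Ring.NaturalCoefficients.Default as NaturalCoefficients
open import Algebra.Structures using (IsCommutativeRing)
open import Data.Bool.Base using (true; false; if_then_else_)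
open import Data.Fin.Base as Fin using (Fin; zero; suc; toℕ; fromℕ<; inject₁; punchIn)
open import Data.Fin.Properties as Finₚ using (toℕ-fromℕ<; toℕ-injective; toℕ<n)
open import Data.Integer.Base as ℤ using (ℤ; 0ℤ; 1ℤ; +_; -_; _-_)
import Data.Integer.Properties as ℤₚ
open import Data.Integer.Tactic.RingSolver using (solve-∀)
open import Data.List.Base using (List; []; _∷_; [_]; _++_; foldr; map; replicate)
open import Data.List.Properties using (++-identityʳ)
open import Data.Nat.Base as ℕ using (ℕ; zero; suc; _∸_; _^_; _≤_; _<_; _≥_; z≤n; s≤s; z<s; s<s; NonZero; NonTrivial)
open import Data.Nat.Coprimality using (Coprime; coprime-divisor; coprime⇒gcd≡1)
open import Data.Nat.Divisibility using (_∣_; divides; ∣-trans; ∣⇒≤; ∣1⇒≡1; m∣m*n; m%n≡0⇒n∣m; n∣m⇒m%n≡0)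
open import Data.Nat.DivMod using (_%_; m%n<n; m%n≤m; m<n⇒m%n≡m; [m+n]%n≡m%n; %-distribˡ-+; %-remove-+ˡ; %-remove-+ʳ; m∣n⇒o%n%m≡o%m)
open import Data.Nat.GCD using (gcd; gcd-greatest)
open import Data.Nat.Primality using (Prime; prime⇒nonZero; prime⇒nonTrivial; prime⇒irreducible)
import Data.Nat.Properties as ℕₚ
open import Data.Product.Base using (_×_; _,_)
open import Data.Sum.Base using (inj₁; inj₂)
open import Function.Base using (_∘_)
open import Function.Bundles using (mk⇔)
open import Level using (0ℓ)
open import Relation.Binary.Definitions using (tri<; tri≈; tri>)
open import Relation.Binary.PropositionalEquality as ≡ using (_≡_; _≢_)
import Relation.Binary.Reasoning.Setoid as SetoidReasoning
open import Relation.Binary.Structures using (IsEquivalence)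
open import Relation.Nullary using (¬_; Dec; yes; no; does; contradiction; ¬?)
open import Relation.Nullary.Decidable using (_×-dec_; dec-true; dec-false; does-⇔)
open import Relation.Unary using (Pred; Decidable)

-- The goal is a factorisation of a polynomial, so exhibiting eigenvectors would still leave the
-- multiplicities to a dimension count. Elimination delivers the factored polynomial directly, but
-- `X` is not invertible in `ℤ[X]`: factors can be pulled out of rows, never divided by. The row
-- operations are therefore carried out over an arbitrary commutative ring, with an element `t` in
-- place of `X`. The determinant is known only through its expansion along the first row, which says
-- nothing about equal rows; the chief obstacle is to show that two equal rows, wherever they stand,
-- make it vanish. Within each elimination step the rows that are added and the rows that change are
-- disjoint, so a whole step can be performed at once. Primality decides adjacency: for positive
-- `m`, `gcd w (p ^ m)` is 1 exactly when `p` does not divide `w`.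

if-yes : ∀ {a p} {A : Set a} {P : Set p} {x y : A} (P? : Dec P) → P → (if does P? then x else y) ≡ x
if-yes {x = x} {y} P? p = ≡.cong (if_then x else y) (dec-true P? p)

if-no : ∀ {a p} {A : Set a} {P : Set p} {x y : A} (P? : Dec P) → ¬ P → (if does P? then x else y) ≡ y
if-no {x = x} {y} P? ¬p = ≡.cong (if_then x else y) (dec-false P? ¬p)

if-does : ∀ {a p q} {A : Set a} {P : Set p} {Q : Set q} {x y : A} (P? : Dec P) (Q? : Dec Q) →
          (P → Q) → (Q → P) → (if does P? then x else y) ≡ (if does Q? then x else y)
if-does {x = x} {y} P? Q? to from = ≡.cong (if_then x else y) (does-⇔ (mk⇔ to from) P? Q?)

module _ {c ℓ} (M : Monoid c ℓ) where
  open Monoid M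
  open MonoidSum M using (sum; sum-cong-≋)

  -- The summand lives on `ℕ`, so a bound can be rewritten along an equation such as n = a + b
  -- without casts between `Fin` types. A general monoid covers sums and products at once.
  sum-split : ∀ a b (g : ℕ → Carrier) →
              sum {a ℕ.+ b} (g ∘ toℕ) ≈ sum {a} (g ∘ toℕ) ∙ sum {b} (λ i → g (a ℕ.+ toℕ i))
  sum-split zero    b g = sym (identityˡ _)
  sum-split (suc a) b g = trans (∙-congˡ (sum-split a b (g ∘ suc))) (sym (assoc _ _ _))

  sum-threshold : ∀ a b u v → sum {a ℕ.+ b} (λ i → if does (toℕ i ℕₚ.<? a) then u else v) ≈
                  sum {a} (λ _ → u) ∙ sum {b} (λ _ → v)
  sum-threshold a b u v = trans (sum-split a b (λ i → if does (i ℕₚ.<? a) then u else v)) (∙-cong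
    (sum-cong-≋ λ i → reflexive (if-yes (toℕ i ℕₚ.<? a) (toℕ<n i)))
    (sum-cong-≋ {b} λ i → reflexive (if-no (a ℕ.+ toℕ i ℕₚ.<? a) (ℕₚ.m+n≮m a (toℕ i)))))

-- Determinants and row operations over a commutative ring

module DeterminantProperties (R : CommutativeRing 0ℓ 0ℓ) where
  open CommutativeRing R hiding (zero; _-_) renaming (-_ to neg)
  open Determinant rawRing
  open RawSemiringDefs (Semiring.rawSemiring semiring) using (product) renaming (_^_ to _^ᴿ_)
  open SemiringSum semiring using (sum; sum-cong-≋; sum-replicate-zero; ∑-distrib-+; *-distribˡ-sum)
  open RingProperties ring using (-1*x≈-x)
  open NaturalCoefficients commutativeSemiring using (solve; con; _:=_; _:+_; _:*_)
  open SetoidReasoning setoid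

  -- The solver works in commutative semirings, so -1 is handed to it as an atom. Cancellations are
  -- first collected into a term `(1# + -1#) * x`, which is then discarded by hand.
  -1# : Carrier
  -1# = neg 1#

  1+-1≈0 : 1# + -1# ≈ 0#
  1+-1≈0 = -‿inverseʳ 1#

  [1+-1]*x≈0 : ∀ x → (1# + -1#) * x ≈ 0#
  [1+-1]*x≈0 x = trans (*-congʳ 1+-1≈0) (zeroˡ x)

  x+-1*x≈0 : ∀ x → x + -1# * x ≈ 0#
  x+-1*x≈0 x = trans (+-congˡ (-1*x≈-x x)) (-‿inverseʳ x)

  sum-zero : ∀ {n} {f : Fin n → Carrier} → (∀ i → f i ≈ 0#) → sum f ≈ 0#
  sum-zero {n} f≈0 = trans (sum-cong-≋ f≈0) (sum-replicate-zero n)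

  sum-linear : ∀ {n} a b (f g : Fin n → Carrier) →
               sum (λ i → a * f i + b * g i) ≈ a * sum f + b * sum g
  sum-linear a b f g = trans (∑-distrib-+ (λ i → a * f i) (λ i → b * g i))
    (+-cong (sym (*-distribˡ-sum a f)) (sym (*-distribˡ-sum b g)))

  infix 4 _≈ₘ_
  _≈ₘ_ : ∀ {n} → Matrix Carrier n → Matrix Carrier n → Set
  M ≈ₘ N = ∀ r k → M r k ≈ N r k

  sgn : ∀ {n} → Fin n → Carrier
  sgn j = -1# ^ᴿ toℕ j

  cofactorTerm : ∀ {n} → Matrix Carrier (suc n) → Fin (suc n) → Carrier
  cofactorTerm M j = sgn j * (M zero j * det (minor M j))

  AgreeOff : ∀ {n} → Fin n → Matrix Carrier n → Matrix Carrier n → Set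
  AgreeOff i M N = ∀ r → r ≢ i → ∀ k → M r k ≈ N r k

  det-cong : ∀ {n} {M N : Matrix Carrier n} → M ≈ₘ N → det M ≈ det N
  det-cong {zero}  M≈N = refl
  det-cong {suc n} {M} {N} M≈N = sum-cong-≋ {x = cofactorTerm M} {y = cofactorTerm N} λ j →
    *-congˡ {sgn j} (*-cong (M≈N zero j) (det-cong λ r k → M≈N (suc r) (punchIn j k)))

  -- Linearity is stated as a relation between three matrices that are compared entry by entry,
  -- since matrices are functions and pointwise `≈` does not make them equal. For row 0 the
  -- cofactors agree; for a later row the claim descends to the minors.
  det-linear : ∀ {n} (i : Fin n) a b {M N P : Matrix Carrier n} →
               AgreeOff i M P → AgreeOff i N P →
               (∀ k → P i k ≈ a * M i k + b * N i k) →
               det P ≈ a * det M + b * det N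
  det-linear {suc n} zero a b {M} {N} {P} M~P N~P Pᵢ = trans
    (sum-cong-≋ {x = cofactorTerm P} {y = λ j → a * cofactorTerm M j + b * cofactorTerm N j} λ j → begin
      sgn j * (P zero j * det (minor P j))
        ≈⟨ *-congˡ (*-congʳ (Pᵢ j)) ⟩
      sgn j * ((a * M zero j + b * N zero j) * det (minor P j))
        ≈⟨ solve 6 (λ s a b m n d → s :* ((a :* m :+ b :* n) :* d) :=
             a :* (s :* (m :* d)) :+ b :* (s :* (n :* d))) refl (sgn j) a b _ _ _ ⟩
      a * (sgn j * (M zero j * det (minor P j))) + b * (sgn j * (N zero j * det (minor P j)))
        ≈⟨ +-cong (*-congˡ (*-congˡ (*-congˡ (det-cong λ r k → sym (M~P (suc r) (λ ()) (punchIn j k))))))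
                  (*-congˡ (*-congˡ (*-congˡ (det-cong λ r k → sym (N~P (suc r) (λ ()) (punchIn j k)))))) ⟩
      a * (sgn j * (M zero j * det (minor M j))) + b * (sgn j * (N zero j * det (minor N j))) ∎)
    (sum-linear a b (cofactorTerm M) (cofactorTerm N))
  det-linear {suc n} (suc i) a b {M} {N} {P} M~P N~P Pᵢ = trans
    (sum-cong-≋ {x = cofactorTerm P} {y = λ j → a * cofactorTerm M j + b * cofactorTerm N j} λ j → begin
      sgn j * (P zero j * det (minor P j))
        ≈⟨ *-congˡ (*-congˡ (det-linear i a b
             (λ r r≢i k → M~P (suc r) (r≢i ∘ Finₚ.suc-injective) (punchIn j k))
             (λ r r≢i k → N~P (suc r) (r≢i ∘ Finₚ.suc-injective) (punchIn j k))
             (λ k → Pᵢ (punchIn j k)))) ⟩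
      sgn j * (P zero j * (a * det (minor M j) + b * det (minor N j)))
        ≈⟨ solve 6 (λ s a b p d e → s :* (p :* (a :* d :+ b :* e)) :=
             a :* (s :* (p :* d)) :+ b :* (s :* (p :* e))) refl (sgn j) a b _ _ _ ⟩
      a * (sgn j * (P zero j * det (minor M j))) + b * (sgn j * (P zero j * det (minor N j)))
        ≈⟨ +-cong (*-congˡ (*-congˡ (*-congʳ (sym (M~P zero (λ ()) j)))))
                  (*-congˡ (*-congˡ (*-congʳ (sym (N~P zero (λ ()) j))))) ⟩
      a * (sgn j * (M zero j * det (minor M j))) + b * (sgn j * (N zero j * det (minor N j))) ∎)
    (sum-linear a b (cofactorTerm M) (cofactorTerm N))

  infixl 6 _[_≔_]
  _[_≔_] : ∀ {n} → Matrix Carrier n → Fin n → (Fin n → Carrier) → Matrix Carrier n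
  (M [ i ≔ u ]) r = if does (r Finₚ.≟ i) then u else M r

  set-at : ∀ {n} (M : Matrix Carrier n) i u → (M [ i ≔ u ]) i ≡ u
  set-at M i u = if-yes (i Finₚ.≟ i) ≡.refl

  set-off : ∀ {n} (M : Matrix Carrier n) i u {r} → r ≢ i → (M [ i ≔ u ]) r ≡ M r
  set-off M i u {r} r≢i = if-no (r Finₚ.≟ i) r≢i

  set-at-≈ : ∀ {n} (M : Matrix Carrier n) i u k → (M [ i ≔ u ]) i k ≈ u k
  set-at-≈ M i u k = reflexive (≡.cong (λ v → v k) (set-at M i u))

  set-off-≈ : ∀ {n} (M : Matrix Carrier n) i u → AgreeOff i (M [ i ≔ u ]) M
  set-off-≈ M i u r r≢i k = reflexive (≡.cong (λ v → v k) (set-off M i u r≢i))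

  set-agree : ∀ {n} (M : Matrix Carrier n) i u v → AgreeOff i (M [ i ≔ u ]) (M [ i ≔ v ])
  set-agree M i u v r r≢i k = trans (set-off-≈ M i u r r≢i k) (sym (set-off-≈ M i v r r≢i k))

  det-set-linear : ∀ {n} (M : Matrix Carrier n) i a b u v →
                   det (M [ i ≔ (λ k → a * u k + b * v k) ]) ≈ a * det (M [ i ≔ u ]) + b * det (M [ i ≔ v ])
  det-set-linear M i a b u v = det-linear i a b (set-agree M i u _) (set-agree M i v _) λ k →
    trans (set-at-≈ M i _ k) (sym (+-cong (*-congˡ (set-at-≈ M i u k)) (*-congˡ (set-at-≈ M i v k))))

  det-set-sum : ∀ {n} (M : Matrix Carrier n) i {m} (c : Fin m → Carrier) (u : Fin m → Fin n → Carrier) →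
                det (M [ i ≔ (λ k → sum λ s → c s * u s k) ]) ≈ sum λ s → c s * det (M [ i ≔ u s ])
  det-set-sum M i {zero} c u = begin
    det (M [ i ≔ (λ _ → 0#) ])
      -- The empty combination is the zero row, which is 0 times itself plus 0 times itself;
      -- linearity applied to the matrix itself then gives 0.
      ≈⟨ det-linear i 0# 0# (λ _ _ _ → refl) (λ _ _ _ → refl) (λ k → trans (set-at-≈ M i _ k)
           (solve 1 (λ x → con 0 := con 0 :* x :+ con 0 :* x) refl _)) ⟩
    0# * D + 0# * D
      ≈⟨ solve 1 (λ x → con 0 :* x :+ con 0 :* x := con 0) refl D ⟩
    0# ∎
    where
    D = det (M [ i ≔ (λ _ → 0#) ])
  det-set-sum M i {suc m} c u = begin
    det (M [ i ≔ (λ k → c zero * u zero k + sum (λ s → c (suc s) * u (suc s) k)) ])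
      ≈⟨ det-linear i (c zero) 1# (set-agree M i (u zero) _)
           (set-agree M i (λ k → sum λ s → c (suc s) * u (suc s) k) _) (λ k → trans (set-at-≈ M i _ k)
             (+-cong (*-congˡ (sym (set-at-≈ M i (u zero) k)))
                     (trans (sym (*-identityˡ _)) (*-congˡ (sym (set-at-≈ M i _ k)))))) ⟩
    c zero * det (M [ i ≔ u zero ]) + 1# * det (M [ i ≔ (λ k → sum λ s → c (suc s) * u (suc s) k) ])
      ≈⟨ +-congˡ (trans (*-identityˡ _) (det-set-sum M i (c ∘ suc) (u ∘ suc))) ⟩
    c zero * det (M [ i ≔ u zero ]) + sum (λ s → c (suc s) * det (M [ i ≔ u (suc s) ])) ∎

  -- Deleting two columns: the pair (i, k) with i ≤ k stands for the columns
  -- i < k + 1, which the pair (k + 1, i) reaches in the other order.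
  sum-antisymmetric : ∀ {n} (F : Fin (suc n) → Fin n → Carrier) →
    (∀ i k → toℕ i ≤ toℕ k → F (inject₁ i) k + F (suc k) i ≈ 0#) →
    sum (λ j → sum (F j)) ≈ 0#
  sum-antisymmetric {zero}  F anti = sum-zero {1} λ _ → refl
  sum-antisymmetric {suc n} F anti = begin
    sum (F zero) + sum (λ j → F (suc j) zero + sum (F (suc j) ∘ suc))
      ≈⟨ +-congˡ (∑-distrib-+ (λ j → F (suc j) zero) (λ j → sum (F (suc j) ∘ suc))) ⟩
    sum (F zero) + (sum (λ j → F (suc j) zero) + sum (λ j → sum (F (suc j) ∘ suc)))
      ≈⟨ sym (+-assoc _ _ _) ⟩
    sum (F zero) + sum (λ j → F (suc j) zero) + sum (λ j → sum (F (suc j) ∘ suc))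
      ≈⟨ +-cong (trans (sym (∑-distrib-+ (F zero) (λ j → F (suc j) zero)))
                       (sum-zero λ k → anti zero k z≤n))
                (sum-antisymmetric (λ j k → F (suc j) (suc k)) λ i k i≤k → anti (suc i) (suc k) (s≤s i≤k)) ⟩
    0# + 0#
      ≈⟨ +-identityˡ 0# ⟩
    0# ∎

  -- The cosimplicial identity: deleting two columns in either order leaves the same columns, so
  -- both orders produce the same second minor.
  punchIn-punchIn : ∀ {n} (i k : Fin (suc n)) → toℕ i ≤ toℕ k → ∀ (l : Fin n) →
                    punchIn (inject₁ i) (punchIn k l) ≡ punchIn (suc k) (punchIn i l)
  punchIn-punchIn zero    k       i≤k       l       = ≡.refl
  punchIn-punchIn (suc i) (suc k) (s≤s i≤k) zero    = ≡.refl
  punchIn-punchIn (suc i) (suc k) (s≤s i≤k) (suc l) = ≡.cong suc (punchIn-punchIn i k i≤k l)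

  punchIn-inject₁ : ∀ {n} (i k : Fin n) → toℕ i ≤ toℕ k → punchIn (inject₁ i) k ≡ suc k
  punchIn-inject₁ zero    k       i≤k       = ≡.refl
  punchIn-inject₁ (suc i) (suc k) (s≤s i≤k) = ≡.cong suc (punchIn-inject₁ i k i≤k)

  punchIn-suc : ∀ {n} (i k : Fin n) → toℕ i ≤ toℕ k → punchIn (suc k) i ≡ inject₁ i
  punchIn-suc zero    k       i≤k       = ≡.refl
  punchIn-suc (suc i) (suc k) (s≤s i≤k) = ≡.cong suc (punchIn-suc i k i≤k)

  -- Expanding along both rows gives one term for each ordered pair of distinct columns. The two
  -- orders of a pair share their minor and, the rows being equal, their entries; the shift by one
  -- in `sgn (suc k)` contributes the opposite sign.
  det-row₀≈row₁ : ∀ {n} (M : Matrix Carrier (suc (suc n))) →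
                  (∀ k → M zero k ≈ M (suc zero) k) → det M ≈ 0#
  det-row₀≈row₁ {n} M eq = trans
    (sum-cong-≋ {x = cofactorTerm M} {y = λ j → sum (F j)} λ j → trans
      (*-congˡ {sgn j} (*-distribˡ-sum (M zero j) (cofactorTerm (minor M j))))
      (*-distribˡ-sum (sgn j) λ k → M zero j * cofactorTerm (minor M j) k))
    (sum-antisymmetric F anti)
    where
    F : Fin (suc (suc n)) → Fin (suc n) → Carrier
    F j k = sgn j * (M zero j * cofactorTerm (minor M j) k)
    anti : ∀ i k → toℕ i ≤ toℕ k → F (inject₁ i) k + F (suc k) i ≈ 0#
    anti i k i≤k = begin
      F (inject₁ i) k + F (suc k) i
        ≈⟨ +-cong
             (*-cong (reflexive (≡.cong (-1# ^ᴿ_) (Finₚ.toℕ-inject₁ i)))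
               (*-congˡ (*-congˡ (*-congʳ (trans (reflexive (≡.cong (M (suc zero)) (punchIn-inject₁ i k i≤k)))
                                                 (sym (eq (suc k))))))))
             (*-congˡ (*-congˡ (*-congˡ (*-cong
               (trans (reflexive (≡.cong (M (suc zero)) (punchIn-suc i k i≤k))) (sym (eq (inject₁ i))))
               (det-cong λ r l → reflexive (≡.cong (M (suc (suc r))) (≡.sym (punchIn-punchIn i k i≤k l)))))))) ⟩
      sgn i * (a * (sgn k * (b * d))) + -1# * sgn k * (b * (sgn i * (a * d)))
        ≈⟨ solve 6 (λ s si sk a b d →
             si :* (a :* (sk :* (b :* d))) :+ s :* sk :* (b :* (si :* (a :* d))) :=
             (con 1 :+ s) :* (si :* sk :* a :* b :* d)) refl -1# (sgn i) (sgn k) a b d ⟩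
      (1# + -1#) * (sgn i * sgn k * a * b * d)
        ≈⟨ [1+-1]*x≈0 _ ⟩
      0# ∎
      where
      a = M zero (inject₁ i)
      b = M zero (suc k)
      d = det (minor (minor M (inject₁ i)) k)

  AlternatingAt : ∀ {n} → Fin n → Fin n → Set
  AlternatingAt i j = ∀ M → (∀ k → M i k ≈ M j k) → det M ≈ 0#

  -- Polarisation: a matrix carrying `u+v` in both rows has determinant 0, and expanding it by
  -- linearity leaves the two mixed terms, as those with `u` twice or `v` twice vanish. It is stated
  -- for a single pair of rows so that it can be used inside the induction that proves alternation.
  alternating⇒swap : ∀ {n} (i j : Fin n) → AlternatingAt i j → ∀ M N → i ≢ j →
    (∀ k → M i k ≈ N j k) → (∀ k → M j k ≈ N i k) → (∀ r → r ≢ i → r ≢ j → ∀ k → M r k ≈ N r k) →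
    det M + det N ≈ 0#
  alternating⇒swap {n} i j alt M N i≢j Mᵢ≈Nⱼ Mⱼ≈Nᵢ M≈N = begin
    det M + det N
      ≈⟨ +-cong (det-cong M≈W) (det-cong N≈W) ⟩
    det (W u v) + det (W v u)
      ≈⟨ sym (+-cong (+-identityˡ _) (+-identityʳ _)) ⟩
    (0# + det (W u v)) + (det (W v u) + 0#)
      ≈⟨ sym (+-cong (+-congʳ (W-alt u)) (+-congˡ (W-alt v))) ⟩
    (det (W u u) + det (W u v)) + (det (W v u) + det (W v v))
      ≈⟨ solve 4 (λ a b c d → (a :+ b) :+ (c :+ d) :=
           con 1 :* (con 1 :* a :+ con 1 :* c) :+ con 1 :* (con 1 :* b :+ con 1 :* d)) refl _ _ _ _ ⟩
    1# * (1# * det (W u u) + 1# * det (W v u)) + 1# * (1# * det (W u v) + 1# * det (W v v))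
      ≈⟨ sym (+-cong (*-congˡ (W-linearˡ u)) (*-congˡ (W-linearˡ v))) ⟩
    1# * det (W u+v u) + 1# * det (W u+v v)
      ≈⟨ sym (det-set-linear (M [ i ≔ u+v ]) j 1# 1# u v) ⟩
    det (W u+v u+v)
      ≈⟨ W-alt u+v ⟩
    0# ∎
    where
    u v u+v : Fin n → Carrier
    u = M i
    v = M j
    u+v k = 1# * u k + 1# * v k
    W : (Fin n → Carrier) → (Fin n → Carrier) → Matrix Carrier n
    W x y = M [ i ≔ x ] [ j ≔ y ]
    Wᵢ : ∀ x y k → W x y i k ≈ x k
    Wᵢ x y k = trans (set-off-≈ (M [ i ≔ x ]) j y i i≢j k) (set-at-≈ M i x k)
    Wⱼ : ∀ x y k → W x y j k ≈ y k
    Wⱼ x y k = set-at-≈ (M [ i ≔ x ]) j y k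
    Wᵣ : ∀ x y r → r ≢ i → r ≢ j → ∀ k → W x y r k ≈ M r k
    Wᵣ x y r r≢i r≢j k = trans (set-off-≈ (M [ i ≔ x ]) j y r r≢j k) (set-off-≈ M i x r r≢i k)
    W-alt : ∀ x → det (W x x) ≈ 0#
    W-alt x = alt (W x x) λ k → trans (Wᵢ x x k) (sym (Wⱼ x x k))
    W-agree : ∀ x x′ y → AgreeOff i (W x y) (W x′ y)
    W-agree x x′ y r r≢i k with r Finₚ.≟ j
    ... | yes _ = refl
    ... | no _  = set-agree M i x x′ r r≢i k
    W-linearˡ : ∀ y → det (W u+v y) ≈ 1# * det (W u y) + 1# * det (W v y)
    W-linearˡ y = det-linear i 1# 1# (W-agree u u+v y) (W-agree v u+v y) λ k →
      trans (Wᵢ u+v y k) (sym (+-cong (*-congˡ (Wᵢ u y k)) (*-congˡ (Wᵢ v y k))))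
    ≈W : ∀ {P : Matrix Carrier n} x y → (∀ k → P i k ≈ x k) → (∀ k → P j k ≈ y k) →
         (∀ r → r ≢ i → r ≢ j → ∀ k → P r k ≈ M r k) → P ≈ₘ W x y
    ≈W {P} x y Pᵢ Pⱼ Pᵣ r k = go (r Finₚ.≟ i) (r Finₚ.≟ j)
      where
      go : Dec (r ≡ i) → Dec (r ≡ j) → P r k ≈ W x y r k
      go (yes ≡.refl) _            = trans (Pᵢ k) (sym (Wᵢ x y k))
      go (no _)       (yes ≡.refl) = trans (Pⱼ k) (sym (Wⱼ x y k))
      go (no r≢i)     (no r≢j)     = trans (Pᵣ r r≢i r≢j k) (sym (Wᵣ x y r r≢i r≢j k))
    M≈W : M ≈ₘ W u v
    M≈W = ≈W u v (λ _ → refl) (λ _ → refl) (λ _ _ _ _ → refl)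
    N≈W : N ≈ₘ W v u
    N≈W = ≈W v u (λ k → sym (Mⱼ≈Nᵢ k)) (λ k → sym (Mᵢ≈Nⱼ k)) (λ r r≢i r≢j k → sym (M≈N r r≢i r≢j k))

  -- Rows 0 and 1 are the double expansion, and two rows below row 0 are equal in every minor. For
  -- rows 0 and j + 2, exchanging rows 1 and j + 2 gives `N`, whose first two rows agree. Each minor
  -- of `N` is the corresponding minor of `M` with two rows exchanged, so by induction on the size
  -- the determinants of `M` and `N` are opposite.
  det-alternating-< : ∀ {n} {i j : Fin n} → i Fin.< j → AlternatingAt i j
  det-alternating-< {_} {zero} {suc zero} _ M eq = det-row₀≈row₁ M eq
  det-alternating-< {suc (suc (suc n))} {zero} {suc (suc j)} _ M eq = begin
    det M
      ≈⟨ sym (+-identityʳ _) ⟩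
    det M + 0#
      ≈⟨ +-congˡ (sym (det-row₀≈row₁ N eq)) ⟩
    det M + det N
      ≈⟨ sym (∑-distrib-+ (cofactorTerm M) (cofactorTerm N)) ⟩
    sum (λ c → cofactorTerm M c + cofactorTerm N c)
      ≈⟨ sum-zero (λ c → begin
           sgn c * (M zero c * det (minor M c)) + sgn c * (M zero c * det (minor N c))
             ≈⟨ solve 4 (λ s m d e → s :* (m :* d) :+ s :* (m :* e) := s :* m :* (d :+ e)) refl (sgn c) _ _ _ ⟩
           sgn c * M zero c * (det (minor M c) + det (minor N c))
             ≈⟨ *-congˡ (alternating⇒swap zero (suc j) (det-alternating-< z<s) (minor M c) (minor N c) (λ ())
                  (λ k → reflexive (≡.cong (λ v → v (punchIn c k)) (≡.sym (set-at (M [ suc zero ≔ M (suc (suc j)) ]) (suc (suc j)) (M (suc zero))))))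
                  (λ k → refl)
                  (λ { zero 0≢0 _ → contradiction ≡.refl 0≢0
                     ; (suc r) _ r≢j k → sym (set-off-≈ (M [ suc zero ≔ M (suc (suc j)) ]) (suc (suc j)) (M (suc zero))
                                                (suc (suc r)) (r≢j ∘ Finₚ.suc-injective) (punchIn c k)) })) ⟩
           sgn c * M zero c * 0#
             ≈⟨ zeroʳ _ ⟩
           0# ∎) ⟩
    0# ∎
    where
    N : Matrix Carrier (suc (suc (suc n)))
    N = M [ suc zero ≔ M (suc (suc j)) ] [ suc (suc j) ≔ M (suc zero) ]
  det-alternating-< {_} {suc i} {suc j} (s<s i<j) M eq = sum-zero {f = cofactorTerm M} λ c → trans
    (*-congˡ {sgn c} (trans (*-congˡ {M zero c} (det-alternating-< i<j (minor M c) (λ k → eq (punchIn c k)))) (zeroʳ _)))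
    (zeroʳ _)

  det-alternating : ∀ {n} {i j : Fin n} → i ≢ j → AlternatingAt i j
  det-alternating {_} {i} {j} i≢j M eq with Finₚ.<-cmp i j
  ... | tri< i<j _ _ = det-alternating-< i<j M eq
  ... | tri≈ _ i≡j _ = contradiction i≡j i≢j
  ... | tri> _ _ j<i = det-alternating-< j<i M (sym ∘ eq)

  -- By linearity the change is a sum of determinants in which row `i` is replaced by row `s`. Such
  -- a matrix has two equal rows unless `s` is `i`, and there the coefficient vanishes.
  det-addCombination : ∀ {n} (i : Fin n) (c : Fin n → Carrier) {M N : Matrix Carrier n} → c i ≈ 0# →
    AgreeOff i M N → (∀ k → N i k ≈ M i k + sum (λ s → c s * M s k)) → det N ≈ det M
  det-addCombination i c {M} {N} cᵢ≈0 M~N Nᵢ = begin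
    det N
      ≈⟨ det-linear i 1# 1# M~N (λ r r≢i k → trans (set-off-≈ M i _ r r≢i k) (M~N r r≢i k))
           (λ k → trans (Nᵢ k) (+-cong (sym (*-identityˡ _))
             (trans (sym (set-at-≈ M i _ k)) (sym (*-identityˡ _))))) ⟩
    1# * det M + 1# * det (M [ i ≔ (λ k → sum λ s → c s * M s k) ])
      ≈⟨ +-cong (*-identityˡ _) (*-identityˡ _) ⟩
    det M + det (M [ i ≔ (λ k → sum λ s → c s * M s k) ])
      ≈⟨ +-congˡ (trans (det-set-sum M i c M) (sum-zero λ s → vanish s (s Finₚ.≟ i))) ⟩
    det M + 0#
      ≈⟨ +-identityʳ _ ⟩
    det M ∎
    where
    vanish : ∀ s → Dec (s ≡ i) → c s * det (M [ i ≔ M s ]) ≈ 0#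
    vanish s (yes ≡.refl) = trans (*-congʳ cᵢ≈0) (zeroˡ _)
    vanish s (no s≢i)     = trans (*-congˡ (det-alternating (s≢i ∘ ≡.sym) (M [ i ≔ M s ]) λ k →
      trans (set-at-≈ M i (M s) k) (sym (set-off-≈ M i (M s) s s≢i k)))) (zeroʳ _)

  det-scaleRows : ∀ {n} (d : Fin n → Carrier) {M N : Matrix Carrier n} →
                  (∀ r k → N r k ≈ d r * M r k) → det N ≈ product d * det M
  det-scaleRows {zero}  d eq = sym (*-identityˡ _)
  det-scaleRows {suc n} d {M} {N} eq = trans
    (sum-cong-≋ {x = cofactorTerm N} {y = λ j → product d * cofactorTerm M j} λ j → begin
      sgn j * (N zero j * det (minor N j))
        ≈⟨ *-congˡ (*-cong (eq zero j) (det-scaleRows (d ∘ suc) λ r k → eq (suc r) (punchIn j k))) ⟩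
      sgn j * ((d zero * M zero j) * (product (d ∘ suc) * det (minor M j)))
        ≈⟨ solve 5 (λ s a m b e → s :* ((a :* m) :* (b :* e)) := (a :* b) :* (s :* (m :* e))) refl
             (sgn j) (d zero) (M zero j) (product (d ∘ suc)) (det (minor M j)) ⟩
      (d zero * product (d ∘ suc)) * cofactorTerm M j ∎)
    (sym (*-distribˡ-sum (product d) (cofactorTerm M)))

  det-lowerTriangular : ∀ {n} (M : Matrix Carrier n) → (∀ {i k} → i Fin.< k → M i k ≈ 0#) →
                        det M ≈ product (λ i → M i i)
  det-lowerTriangular {zero}  M lower = refl
  det-lowerTriangular {suc n} M lower = begin
    1# * (M zero zero * det (minor M zero)) + sum (λ j → cofactorTerm M (suc j))
      ≈⟨ +-cong (*-identityˡ _) (sum-zero {f = λ j → cofactorTerm M (suc j)} λ j →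
           trans (*-congˡ {sgn (suc j)} (trans (*-congʳ (lower z<s)) (zeroˡ _))) (zeroʳ _)) ⟩
    M zero zero * det (minor M zero) + 0#
      ≈⟨ +-identityʳ _ ⟩
    M zero zero * det (minor M zero)
      ≈⟨ *-congˡ (det-lowerTriangular (minor M zero) (lower ∘ s<s)) ⟩
    M zero zero * product (λ i → M (suc i) (suc i)) ∎

  module _ {n} {T : Pred (Fin n) 0ℓ} (T? : Decidable T) (C : Fin n → Fin n → Carrier)
           (C≈0 : ∀ r {s} → T s → C r s ≈ 0#) {M N : Matrix Carrier n}
           (N-on : ∀ {r} → T r → ∀ k → N r k ≈ M r k + sum (λ s → C r s * M s k))
           (N-off : ∀ {r} → ¬ T r → ∀ k → N r k ≈ M r k) where

    private
      -- Rows in T are never used as sources, so they can be replaced one at a time.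
      hybrid : ℕ → Matrix Carrier n
      hybrid m r = if does (toℕ r ℕₚ.<? m) then N r else M r

      hybrid-< : ∀ {m r} → toℕ r < m → hybrid m r ≡ N r
      hybrid-< {m} {r} r<m = if-yes (toℕ r ℕₚ.<? m) r<m

      hybrid-≥ : ∀ {m r} → ¬ toℕ r < m → hybrid m r ≡ M r
      hybrid-≥ {m} {r} r≮m = if-no (toℕ r ℕₚ.<? m) r≮m

      row≡ : ∀ {u v : Fin n → Carrier} → u ≡ v → ∀ k → u k ≈ v k
      row≡ eq k = reflexive (≡.cong (λ w → w k) eq)

      hybrid-off : ∀ m {r} → ¬ T r → ∀ k → hybrid m r k ≈ M r k
      hybrid-off m {r} ¬Tr k with does (toℕ r ℕₚ.<? m)
      ... | true  = N-off ¬Tr k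
      ... | false = refl

      hybrid-step : ∀ {m} → m < n → det (hybrid (suc m)) ≈ det (hybrid m)
      hybrid-step {m} m<n = go (T? i)
        where
        i = fromℕ< m<n
        i≡m : toℕ i ≡ m
        i≡m = toℕ-fromℕ< m<n
        agree : AgreeOff i (hybrid m) (hybrid (suc m))
        agree r r≢i with ℕₚ.<-cmp (toℕ r) m
        ... | tri< r<m _ _ = row≡ (≡.trans (hybrid-< r<m) (≡.sym (hybrid-< (ℕₚ.m<n⇒m<1+n r<m))))
        ... | tri≈ _ r≡m _ = contradiction (toℕ-injective (≡.trans r≡m (≡.sym i≡m))) r≢i
        ... | tri> r≮m _ m<r = row≡ (≡.trans (hybrid-≥ r≮m) (≡.sym (hybrid-≥ (ℕₚ.≤⇒≯ m<r))))
        entry : ∀ k s → Dec (T s) → C i s * M s k ≈ C i s * hybrid m s k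
        entry k s (yes Ts) = trans (C*≈0 _) (sym (C*≈0 _))
          where
          C*≈0 : ∀ x → C i s * x ≈ 0#
          C*≈0 x = trans (*-congʳ (C≈0 i Ts)) (zeroˡ x)
        entry k s (no ¬Ts) = *-congˡ (sym (hybrid-off m ¬Ts k))
        go : Dec (T i) → det (hybrid (suc m)) ≈ det (hybrid m)
        go (yes Ti) = det-addCombination i (C i) (C≈0 i Ti) agree λ k → begin
          hybrid (suc m) i k
            ≈⟨ row≡ (hybrid-< (s≤s (ℕₚ.≤-reflexive i≡m))) k ⟩
          N i k
            ≈⟨ N-on Ti k ⟩
          M i k + sum (λ s → C i s * M s k)
            ≈⟨ +-cong (sym (row≡ (hybrid-≥ (ℕₚ.<-irrefl i≡m)) k))
                 (sum-cong-≋ λ s → entry k s (T? s)) ⟩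
          hybrid m i k + sum (λ s → C i s * hybrid m s k) ∎
        go (no ¬Ti) = det-cong λ r k → row r k (r Finₚ.≟ i)
          where
          row : ∀ r k → Dec (r ≡ i) → hybrid (suc m) r k ≈ hybrid m r k
          row r k (yes ≡.refl) = trans (hybrid-off (suc m) ¬Ti k) (sym (hybrid-off m ¬Ti k))
          row r k (no r≢i)     = sym (agree r r≢i k)

      det-hybrid : ∀ {m} → m ≤ n → det (hybrid m) ≈ det M
      det-hybrid {zero}  _   = refl
      det-hybrid {suc m} m<n = trans (hybrid-step m<n) (det-hybrid (ℕₚ.<⇒≤ m<n))

    det-addCombinations : det N ≈ det M
    det-addCombinations = trans (det-cong λ r → row≡ (≡.sym (hybrid-< (toℕ<n r)))) (det-hybrid ℕₚ.≤-refl)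

  -- The common shape of all elimination steps: rows in `T` receive combinations of rows outside
  -- `T`, and a factor `d r` is then extracted. Writing the result as `d r * N r k` avoids any
  -- division.
  det-reduceRows : ∀ {n} {T : Pred (Fin n) 0ℓ} → Decidable T → (C : Fin n → Fin n → Carrier) (d : Fin n → Carrier) →
    (∀ r {s} → T s → C r s ≈ 0#) → (∀ {r} → ¬ T r → d r ≈ 1#) → ∀ {M N} →
    (∀ {r} → T r → ∀ k → M r k + sum (λ s → C r s * M s k) ≈ d r * N r k) →
    (∀ {r} → ¬ T r → ∀ k → M r k ≈ N r k) →
    det M ≈ product d * det N
  det-reduceRows T? C d C≈0 d≈1 {M} {N} on off = trans
    (sym (det-addCombinations T? C C≈0 {M} {λ r k → d r * N r k} (λ Tr k → sym (on Tr k))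
       (λ ¬Tr k → trans (trans (*-congʳ (d≈1 ¬Tr)) (*-identityˡ _)) (sym (off ¬Tr k)))))
    (det-scaleRows d λ _ _ → refl)

-- Elimination for complete multipartite graphs

module Multipartite (R : CommutativeRing 0ℓ 0ℓ) where
  open CommutativeRing R hiding (zero)
  open Determinant rawRing
  open RawSemiringDefs (Semiring.rawSemiring semiring) using (product)
  open SemiringSum semiring using (sum; sum-cong-≋; ∑-distrib-+; *-distribˡ-sum)
  open MonoidSum *-monoid using () renaming (sum-cong-≋ to product-cong; sum-replicate-zero to product-replicate-one)
  open NaturalCoefficients commutativeSemiring using (solve; con; _:=_; _:+_; _:*_)
  open DeterminantProperties R
  open SetoidReasoning setoid

  -- The Iverson bracket with values in the ring.
  ⟦_⟧ : ∀ {p} {P : Set p} → Dec P → Carrier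
  ⟦ P? ⟧ = if does P? then 1# else 0#

  ⟦yes⟧ : ∀ {p} {P : Set p} (P? : Dec P) → P → ⟦ P? ⟧ ≈ 1#
  ⟦yes⟧ P? p = reflexive (if-yes P? p)

  ⟦no⟧ : ∀ {p} {P : Set p} (P? : Dec P) → ¬ P → ⟦ P? ⟧ ≈ 0#
  ⟦no⟧ P? ¬p = reflexive (if-no P? ¬p)

  δ : ∀ {n} → Fin n → Fin n → Carrier
  δ x y = ⟦ x Finₚ.≟ y ⟧

  sum-δ : ∀ {n} (a : Fin n) (g : Fin n → Carrier) → sum (λ s → δ a s * g s) ≈ g a
  sum-δ zero g = begin
    1# * g zero + sum (λ s → 0# * g (suc s))
      ≈⟨ +-cong (*-identityˡ _) (sum-zero {f = λ s → 0# * g (suc s)} λ s → zeroˡ _) ⟩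
    g zero + 0#
      ≈⟨ +-identityʳ _ ⟩
    g zero ∎
  sum-δ (suc a) g = begin
    0# * g zero + sum (λ s → δ (suc a) (suc s) * g (suc s))
      ≈⟨ +-cong (zeroˡ _) (trans (sum-cong-≋ λ s → *-congʳ (δ-suc s)) (sum-δ a (g ∘ suc))) ⟩
    0# + g (suc a)
      ≈⟨ +-identityˡ _ ⟩
    g (suc a) ∎
    where
    δ-suc : ∀ s → δ (suc a) (suc s) ≈ δ a s
    δ-suc s with a Finₚ.≟ s
    ... | yes _ = refl
    ... | no _  = refl

  sum-*δ : ∀ {n} c (a : Fin n) (g : Fin n → Carrier) → sum (λ s → c * δ a s * g s) ≈ c * g a
  sum-*δ c a g = begin
    sum (λ s → c * δ a s * g s)
      ≈⟨ sum-cong-≋ {x = λ s → c * δ a s * g s} {y = λ s → c * (δ a s * g s)} (λ s → *-assoc c (δ a s) (g s)) ⟩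
    sum (λ s → c * (δ a s * g s))
      ≈⟨ sym (*-distribˡ-sum c (λ s → δ a s * g s)) ⟩
    c * sum (λ s → δ a s * g s)
      ≈⟨ *-congˡ (sum-δ a g) ⟩
    c * g a ∎

  δ-comm : ∀ {n} (x y : Fin n) → δ x y ≈ δ y x
  δ-comm x y with x Finₚ.≟ y
  ... | yes ≡.refl = sym (⟦yes⟧ (x Finₚ.≟ x) ≡.refl)
  ... | no x≢y     = sym (⟦no⟧ (y Finₚ.≟ x) (x≢y ∘ ≡.sym))

  sum-δ′ : ∀ {n} (a : Fin n) (g : Fin n → Carrier) → sum (λ s → g s * δ s a) ≈ g a
  sum-δ′ a g = trans (sum-cong-≋ λ s → trans (*-comm _ _) (*-congʳ (δ-comm s a))) (sum-δ a g)

  -- κ chooses the least vertex of each part; x and y are adjacent iff κ x ≢ κ y.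
  module _ {k : ℕ} (κ : Fin (suc k) → Fin (suc k)) (κ-idem : ∀ x → κ (κ x) ≡ κ x)
           (κ-≤ : ∀ x → κ x Fin.≤ x) (t q : Carrier)
           (classSize : ∀ z → κ z ≡ z → sum (λ x → δ (κ x) z) ≈ q) where

    private
      n = suc k

      Fixed : Pred (Fin n) 0ℓ
      Fixed x = κ x ≡ x

      fixed? : Decidable Fixed
      fixed? x = κ x Finₚ.≟ x

      κ0≡0 : κ zero ≡ zero
      κ0≡0 = toℕ-injective (ℕₚ.n≤0⇒n≡0 (κ-≤ zero))

      fixed : Fin n → Carrier
      fixed x = ⟦ fixed? x ⟧

      adjacent : Fin n → Fin n → Carrier
      adjacent a b = ⟦ ¬? (a Finₚ.≟ b) ⟧

      -- The row vector e_x - e_z at column `y`, read below as an edge of a tree from `x` to its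
      -- parent `z`.
      edge : Fin n → Fin n → Fin n → Carrier
      edge x z y = δ x y + -1# * δ z y

      edge-refl : ∀ x y → edge x x y ≈ 0#
      edge-refl x y = x+-1*x≈0 (δ x y)

      -- A tree rooted at 0: representatives hang below 0 and every other vertex below its
      -- representative. As `κ x` is at most `x`, the parent of a vertex other than the root is
      -- smaller than it, and this makes `M₄` lower triangular with ones on the diagonal below row
      -- 0.
      parent : Fin n → Fin n
      parent x = if does (fixed? x) then zero else κ x

      -- `M₀` is t·I - A. In `M₂` the factor `fixed y` expresses that the columns of
      -- non-representatives are cleared, because `δ x y` already vanishes there for fixed `x`. The
      -- number of parts stays in the form `sum fixed` in `M₄`.
      M₀ M₁ M₂ M₃ M₄ : Matrix Carrier n
      M₀ x y = t * δ x y + -1# * adjacent (κ x) (κ y)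
      M₁ x y = if does (fixed? x) then M₀ x y else edge x (κ x) y
      M₂ x y = if does (fixed? x) then (t + q) * δ x y + -1# * (q * fixed y) else edge x (κ x) y
      M₃ zero    y = M₂ zero y
      M₃ (suc x) y = edge (suc x) (parent (suc x)) y
      M₄ zero    y = (t + q + -1# * (q * sum fixed)) * δ zero y
      M₄ (suc x) y = edge (suc x) (parent (suc x)) y

      -- Vertex 0 is a representative too, but its row is the source of the third step and keeps its
      -- factor. Hence t + q is extracted once for each representative other than 0.
      d₁ d₃ : Fin n → Carrier
      d₁ x = if does (fixed? x) then 1# else t
      d₃ zero    = 1#
      d₃ (suc x) = if does (fixed? (suc x)) then t + q else 1#

      product-one : ∀ m → product {m} (λ _ → 1#) ≈ 1#
      product-one = product-replicate-one

      -- A vertex and its representative have the same neighbours, so the adjacency parts of their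
      -- rows cancel. By `κ-idem` the subtracted row belongs to a representative and is not itself
      -- altered.
      step₁ : det M₀ ≈ product d₁ * det M₁
      step₁ = det-reduceRows (λ x → ¬? (fixed? x)) (λ x s → -1# * δ (κ x) s) d₁
        (λ x {s} κs≢s → trans (*-congˡ (⟦no⟧ (κ x Finₚ.≟ s) λ { ≡.refl → κs≢s (κ-idem x) })) (zeroʳ _))
        (λ {x} ¬¬fix → d₁≈1 x ¬¬fix)
        (λ {x} ¬fix y → begin
          M₀ x y + sum (λ s → -1# * δ (κ x) s * M₀ s y)
            ≈⟨ +-congˡ (sum-*δ -1# (κ x) (λ s → M₀ s y)) ⟩
          M₀ x y + -1# * M₀ (κ x) y
            ≈⟨ +-congˡ (*-congˡ (+-congˡ (*-congˡ (reflexive (≡.cong (λ a → adjacent a (κ y)) (κ-idem x)))))) ⟩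
          M₀ x y + -1# * (t * δ (κ x) y + -1# * adjacent (κ x) (κ y))
            ≈⟨ solve 5 (λ t s a b e → (t :* a :+ s :* e) :+ s :* (t :* b :+ s :* e) :=
                 t :* (a :+ s :* b) :+ (con 1 :+ s) :* (s :* e)) refl t -1# _ _ _ ⟩
          t * edge x (κ x) y + (1# + -1#) * (-1# * adjacent (κ x) (κ y))
            ≈⟨ +-congˡ ([1+-1]*x≈0 _) ⟩
          t * edge x (κ x) y + 0#
            ≈⟨ +-identityʳ _ ⟩
          t * edge x (κ x) y
            ≈⟨ sym (*-cong (reflexive (if-no (fixed? x) ¬fix)) (reflexive (if-no (fixed? x) ¬fix))) ⟩
          d₁ x * M₁ x y ∎)
        (λ {x} ¬¬fix y → off x ¬¬fix y)
        where
        d₁≈1 : ∀ x → ¬ ¬ Fixed x → d₁ x ≈ 1#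
        d₁≈1 x ¬¬fix with fixed? x
        ... | yes _   = refl
        ... | no ¬fix = contradiction ¬fix ¬¬fix
        off : ∀ x → ¬ ¬ Fixed x → ∀ y → M₀ x y ≈ M₁ x y
        off x ¬¬fix y with fixed? x
        ... | yes _   = refl
        ... | no ¬fix = contradiction ¬fix ¬¬fix

      -- Every value of `κ` is fixed, so the fibre over a non-fixed `z` is empty.
      classCount : ∀ z → sum (λ x → δ (κ x) z) ≈ q * fixed z
      classCount z with fixed? z
      ... | yes κz≡z = trans (classSize z κz≡z) (sym (*-identityʳ q))
      ... | no κz≢z  = trans (sum-zero λ x → ⟦no⟧ (κ x Finₚ.≟ z) λ { ≡.refl → κz≢z (κ-idem x) }) (sym (zeroʳ q))

      -- Adding the row e_x - e_(κ x) for each non-representative `x` adjacent to `y` cancels the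
      -- entry -1 in column `x` and moves it to the column of the representative. There each part
      -- adjacent to `y` accumulates its whole size, which is `q`.
      step₂ : det M₁ ≈ det M₂
      step₂ = trans
        (det-reduceRows fixed? (λ y x → adjacent (κ y) (κ x) * ⟦ ¬? (fixed? x) ⟧) (λ _ → 1#)
          (λ y {x} κx≡x → trans (*-congˡ (⟦no⟧ (¬? (fixed? x)) (λ κx≢x → κx≢x κx≡x))) (zeroʳ _))
          (λ _ → refl)
          (λ {y} κy≡y z → trans (row y κy≡y z) (sym (*-identityˡ _)))
          (λ {y} κy≢y z → reflexive (≡.trans (if-no (fixed? y) κy≢y) (≡.sym (if-no (fixed? y) κy≢y)))))
        (trans (*-congʳ (product-one n)) (*-identityˡ _))
        where
        term : ∀ y z x → adjacent (κ y) (κ x) * ⟦ ¬? (fixed? x) ⟧ * M₁ x z ≈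
                         adjacent (κ y) (κ x) * δ x z + -1# * (adjacent (κ y) z * δ (κ x) z)
        term y z x = trans (drop (fixed? x)) (trans
          (solve 4 (λ a b s c → a :* (b :+ s :* c) := a :* b :+ s :* (a :* c)) refl _ _ _ _)
          (+-congˡ (*-congˡ (relabel (κ x Finₚ.≟ z)))))
          where
          -- For a representative the edge row is e_x - e_x = 0, so the sum may run over all
          -- vertices. The fibres of `κ` are then counted in full, giving `q` and not `q` minus one.
          drop : Dec (Fixed x) → adjacent (κ y) (κ x) * ⟦ ¬? (fixed? x) ⟧ * M₁ x z ≈ adjacent (κ y) (κ x) * edge x (κ x) z
          drop (yes κx≡x) = begin
            adjacent (κ y) (κ x) * ⟦ ¬? (fixed? x) ⟧ * M₁ x z
              ≈⟨ *-congʳ (trans (*-congˡ (⟦no⟧ (¬? (fixed? x)) (λ κx≢x → κx≢x κx≡x))) (zeroʳ _)) ⟩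
            0# * M₁ x z
              ≈⟨ zeroˡ _ ⟩
            0#
              ≈⟨ sym (zeroʳ _) ⟩
            adjacent (κ y) (κ x) * 0#
              ≈⟨ *-congˡ (sym (trans (reflexive (≡.cong (λ a → edge x a z) κx≡x)) (edge-refl x z))) ⟩
            adjacent (κ y) (κ x) * edge x (κ x) z ∎
          drop (no κx≢x) = *-cong
            (trans (*-congˡ (⟦yes⟧ (¬? (fixed? x)) κx≢x)) (*-identityʳ _))
            (reflexive (if-no (fixed? x) κx≢x))
          relabel : Dec (κ x ≡ z) → adjacent (κ y) (κ x) * δ (κ x) z ≈ adjacent (κ y) z * δ (κ x) z
          relabel (yes κx≡z) = *-congʳ (reflexive (≡.cong (adjacent (κ y)) κx≡z))
          relabel (no κx≢z)  = trans (*-congˡ (⟦no⟧ (κ x Finₚ.≟ z) κx≢z)) (trans (zeroʳ _)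
            (sym (trans (*-congˡ (⟦no⟧ (κ x Finₚ.≟ z) κx≢z)) (zeroʳ _))))

        -- Adjacency of representatives is 1 - δ, so -q·adjacent becomes q·δ - q; the term q·δ turns
        -- t into t + q.
        entry : ∀ y z → κ y ≡ y → Dec (y ≡ z) →
                t * δ y z + -1# * (adjacent y z * (q * fixed z)) ≈ (t + q) * δ y z + -1# * (q * fixed z)
        entry y z κy≡y (yes ≡.refl) = begin
          t * δ y y + -1# * (adjacent y y * (q * fixed y))
            ≈⟨ +-cong (*-congˡ δ≈1) (*-congˡ (*-congʳ (⟦no⟧ (¬? (y Finₚ.≟ y)) (λ y≢y → y≢y ≡.refl)))) ⟩
          t * 1# + -1# * (0# * (q * fixed y))
            ≈⟨ solve 3 (λ t s x → t :* con 1 :+ s :* (con 0 :* x) := t :+ con 0) refl t -1# _ ⟩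
          t + 0#
            ≈⟨ +-congˡ (sym ([1+-1]*x≈0 q)) ⟩
          t + (1# + -1#) * q
            ≈⟨ solve 3 (λ t s q → t :+ (con 1 :+ s) :* q := (t :+ q) :* con 1 :+ s :* (q :* con 1)) refl t -1# q ⟩
          (t + q) * 1# + -1# * (q * 1#)
            ≈⟨ sym (+-cong (*-congˡ δ≈1) (*-congˡ (*-congˡ (⟦yes⟧ (fixed? y) κy≡y)))) ⟩
          (t + q) * δ y y + -1# * (q * fixed y) ∎
          where
          δ≈1 : δ y y ≈ 1#
          δ≈1 = ⟦yes⟧ (y Finₚ.≟ y) ≡.refl
        entry y z κy≡y (no y≢z) = +-cong
          (trans (*-congˡ δ≈0) (trans (zeroʳ _) (sym (trans (*-congˡ δ≈0) (zeroʳ _)))))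
          (*-congˡ (trans (*-congʳ (⟦yes⟧ (¬? (y Finₚ.≟ z)) y≢z)) (*-identityˡ _)))
          where
          δ≈0 : δ y z ≈ 0#
          δ≈0 = ⟦no⟧ (y Finₚ.≟ z) y≢z

        row : ∀ y → κ y ≡ y → ∀ z → M₁ y z + sum (λ x → adjacent (κ y) (κ x) * ⟦ ¬? (fixed? x) ⟧ * M₁ x z) ≈ M₂ y z
        row y κy≡y z = begin
          M₁ y z + sum (λ x → adjacent (κ y) (κ x) * ⟦ ¬? (fixed? x) ⟧ * M₁ x z)
            ≈⟨ +-cong (reflexive (if-yes (fixed? y) κy≡y)) (sum-cong-≋ (term y z)) ⟩
          M₀ y z + sum (λ x → adjacent (κ y) (κ x) * δ x z + -1# * (adjacent (κ y) z * δ (κ x) z))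
            ≈⟨ +-congˡ (∑-distrib-+ (λ x → adjacent (κ y) (κ x) * δ x z) (λ x → -1# * (adjacent (κ y) z * δ (κ x) z))) ⟩
          M₀ y z + (sum (λ x → adjacent (κ y) (κ x) * δ x z) + sum (λ x → -1# * (adjacent (κ y) z * δ (κ x) z)))
            ≈⟨ +-congˡ (+-cong (sum-δ′ z (λ x → adjacent (κ y) (κ x)))
                 (trans (sym (*-distribˡ-sum -1# (λ x → adjacent (κ y) z * δ (κ x) z)))
                   (*-congˡ (trans (sym (*-distribˡ-sum (adjacent (κ y) z) (λ x → δ (κ x) z))) (*-congˡ (classCount z)))))) ⟩
          M₀ y z + (adjacent (κ y) (κ z) + -1# * (adjacent (κ y) z * (q * fixed z)))
            ≈⟨ solve 4 (λ u s a w → (u :+ s :* a) :+ (a :+ w) := (u :+ w) :+ (con 1 :+ s) :* a) refl _ _ _ _ ⟩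
          t * δ y z + -1# * (adjacent (κ y) z * (q * fixed z)) + (1# + -1#) * adjacent (κ y) (κ z)
            ≈⟨ trans (+-congˡ ([1+-1]*x≈0 _)) (+-identityʳ _) ⟩
          t * δ y z + -1# * (adjacent (κ y) z * (q * fixed z))
            ≈⟨ +-congˡ (*-congˡ (*-congʳ (reflexive (≡.cong (λ a → adjacent a z) κy≡y)))) ⟩
          t * δ y z + -1# * (adjacent y z * (q * fixed z))
            ≈⟨ entry y z κy≡y (y Finₚ.≟ z) ⟩
          (t + q) * δ y z + -1# * (q * fixed z)
            ≈⟨ sym (reflexive (if-yes (fixed? y) κy≡y)) ⟩
          M₂ y z ∎

      step₃ : det M₂ ≈ product d₃ * det M₃
      step₃ = det-reduceRows (λ x → fixed? x ×-dec ¬? (x Finₚ.≟ zero)) (λ x s → -1# * δ zero s) d₃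
        (λ { x {zero} (_ , 0≢0) → contradiction ≡.refl 0≢0 ; x {suc s} _ → zeroʳ _ })
        (λ {x} → d₃≈1 x) (λ {x} (κx≡x , x≢0) y → on x κx≡x x≢0 y) (λ {x} → off x)
        where
        d₃≈1 : ∀ x → ¬ (Fixed x × x ≢ zero) → d₃ x ≈ 1#
        d₃≈1 zero    _  = refl
        d₃≈1 (suc x) ¬T = reflexive (if-no (fixed? (suc x)) λ κx≡x → ¬T (κx≡x , λ ()))
        off : ∀ x → ¬ (Fixed x × x ≢ zero) → ∀ y → M₂ x y ≈ M₃ x y
        off zero    _  y = refl
        off (suc x) ¬T y = reflexive (≡.trans (if-no (fixed? (suc x)) κx≢x)
          (≡.cong (λ a → edge (suc x) a y) (≡.sym (if-no (fixed? (suc x)) κx≢x))))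
          where
          κx≢x : ¬ Fixed (suc x)
          κx≢x κx≡x = ¬T (κx≡x , λ ())
        on : ∀ x → Fixed x → x ≢ zero → ∀ y → M₂ x y + sum (λ s → -1# * δ zero s * M₂ s y) ≈ d₃ x * M₃ x y
        on zero    _    0≢0 y = contradiction ≡.refl 0≢0
        on (suc x) κx≡x _   y = begin
          M₂ (suc x) y + sum (λ s → -1# * δ zero s * M₂ s y)
            ≈⟨ +-congˡ (sum-*δ -1# zero (λ s → M₂ s y)) ⟩
          M₂ (suc x) y + -1# * M₂ zero y
            ≈⟨ +-cong (reflexive (if-yes (fixed? (suc x)) κx≡x)) (*-congˡ (reflexive (if-yes (fixed? zero) κ0≡0))) ⟩
          (t + q) * δ (suc x) y + -1# * (q * fixed y) + -1# * ((t + q) * δ zero y + -1# * (q * fixed y))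
            ≈⟨ solve 5 (λ t s a b e → (t :* a :+ s :* e) :+ s :* (t :* b :+ s :* e) :=
                 t :* (a :+ s :* b) :+ (con 1 :+ s) :* (s :* e)) refl (t + q) -1# _ _ _ ⟩
          (t + q) * edge (suc x) zero y + (1# + -1#) * (-1# * (q * fixed y))
            ≈⟨ trans (+-congˡ ([1+-1]*x≈0 _)) (+-identityʳ _) ⟩
          (t + q) * edge (suc x) zero y
            ≈⟨ sym (*-cong (reflexive (if-yes (fixed? (suc x)) κx≡x))
                 (reflexive (≡.cong (λ a → edge (suc x) a y) (if-yes (fixed? (suc x)) κx≡x)))) ⟩
          d₃ (suc x) * M₃ (suc x) y ∎

      step₄ : det M₃ ≈ det M₄
      step₄ = trans
        (det-reduceRows (Finₚ._≟ zero) C (λ _ → 1#)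
          (λ { x ≡.refl → refl }) (λ _ → refl)
          (λ { ≡.refl y → trans (row y) (sym (*-identityˡ _)) })
          (λ {x} → off x))
        (trans (*-congʳ (product-one n)) (*-identityˡ _))
        where
        C : Fin n → Fin n → Carrier
        -- Row 0 is the one being changed, so it must not be a source. The value 0 costs nothing:
        -- `edge zero zero` vanishes, which lets `term` treat index 0 like the others and produce
        -- the full `sum fixed`.
        C _ zero    = 0#
        C _ (suc s) = q * fixed (suc s)
        off : ∀ x → x ≢ zero → ∀ y → M₃ x y ≈ M₄ x y
        off zero    0≢0 y = contradiction ≡.refl 0≢0
        off (suc x) _   y = refl
        term : ∀ y s → C zero s * M₃ s y ≈ q * (fixed s * δ s y) + -1# * δ zero y * q * fixed s
        term y s = trans (drop s) (solve 5 (λ q f s a b → q :* f :* (a :+ s :* b) := q :* (f :* a) :+ s :* b :* q :* f)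
          refl q (fixed s) -1# (δ s y) (δ zero y))
          where
          drop : ∀ s → C zero s * M₃ s y ≈ q * fixed s * edge s zero y
          drop zero    = trans (zeroˡ _) (sym (trans (*-congˡ (edge-refl zero y)) (zeroʳ _)))
          drop (suc s) with fixed? (suc s)
          ... | yes _ = refl
          ... | no _  = trans (trans (*-congʳ (zeroʳ q)) (zeroˡ _)) (sym (trans (*-congʳ (zeroʳ q)) (zeroˡ _)))
        row : ∀ y → M₃ zero y + sum (λ s → C zero s * M₃ s y) ≈ M₄ zero y
        row y = begin
          M₃ zero y + sum (λ s → C zero s * M₃ s y)
            ≈⟨ +-cong (reflexive (if-yes (fixed? zero) κ0≡0)) (sum-cong-≋ (term y)) ⟩
          (t + q) * δ zero y + -1# * (q * fixed y) + sum (λ s → q * (fixed s * δ s y) + -1# * δ zero y * q * fixed s)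
            ≈⟨ +-congˡ (sum-linear q (-1# * δ zero y * q) (λ s → fixed s * δ s y) fixed) ⟩
          (t + q) * δ zero y + -1# * (q * fixed y) + (q * sum (λ s → fixed s * δ s y) + -1# * δ zero y * q * sum fixed)
            ≈⟨ +-congˡ (+-congʳ (*-congˡ (sum-δ′ y fixed))) ⟩
          (t + q) * δ zero y + -1# * (q * fixed y) + (q * fixed y + -1# * δ zero y * q * sum fixed)
            ≈⟨ solve 6 (λ u s q f d p → u :* d :+ s :* (q :* f) :+ (q :* f :+ s :* d :* q :* p) :=
                 (u :+ s :* (q :* p)) :* d :+ (con 1 :+ s) :* (q :* f)) refl (t + q) -1# q (fixed y) (δ zero y) (sum fixed) ⟩
          M₄ zero y + (1# + -1#) * (q * fixed y)
            ≈⟨ trans (+-congˡ ([1+-1]*x≈0 _)) (+-identityʳ _) ⟩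
          M₄ zero y ∎

      parent< : ∀ x → parent (suc x) Fin.< suc x
      parent< x with fixed? (suc x)
      ... | yes _   = z<s
      ... | no κx≢x = ℕₚ.≤∧≢⇒< (κ-≤ (suc x)) (κx≢x ∘ toℕ-injective)

      δ-≢ : ∀ {x y : Fin n} → x ≢ y → δ x y ≈ 0#
      δ-≢ {x} {y} = ⟦no⟧ (x Finₚ.≟ y)

      <⇒δ≈0 : ∀ {x y : Fin n} → x Fin.< y → δ x y ≈ 0#
      <⇒δ≈0 = δ-≢ ∘ Finₚ.<⇒≢

      det-M₄ : det M₄ ≈ t + q + -1# * (q * sum fixed)
      det-M₄ = begin
        det M₄
          ≈⟨ det-lowerTriangular M₄ (λ {x} → lower x) ⟩
        M₄ zero zero * product (λ x → M₄ (suc x) (suc x))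
          ≈⟨ *-cong (*-identityʳ _) (trans (product-cong diagonal) (product-one k)) ⟩
        (t + q + -1# * (q * sum fixed)) * 1#
          ≈⟨ *-identityʳ _ ⟩
        t + q + -1# * (q * sum fixed) ∎
        where
        lower : ∀ x {y} → x Fin.< y → M₄ x y ≈ 0#
        lower zero    x<y = trans (*-congˡ (<⇒δ≈0 x<y)) (zeroʳ _)
        lower (suc x) x<y = trans (+-cong (<⇒δ≈0 x<y) (trans (*-congˡ (<⇒δ≈0 (ℕₚ.<-trans (parent< x) x<y))) (zeroʳ _))) (+-identityʳ _)
        diagonal : ∀ x → M₄ (suc x) (suc x) ≈ 1#
        diagonal x = trans (+-cong (⟦yes⟧ (suc x Finₚ.≟ suc x) ≡.refl) (trans (*-congˡ (<⇒δ≈0 (parent< x))) (zeroʳ _))) (+-identityʳ _)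

    -- The powers are still products over vertices, with `1#` wherever no factor was extracted; how
    -- many genuine factors occur depends on `κ`. The second product runs over `suc x`, which leaves
    -- out the root.
    det-multipartite :
      det (λ x y → t * δ x y + -1# * ⟦ ¬? (κ x Finₚ.≟ κ y) ⟧) ≈
      product (λ x → if does (κ x Finₚ.≟ x) then 1# else t) *
      (product (λ x → if does (κ (suc x) Finₚ.≟ suc x) then t + q else 1#) *
       (t + q + -1# * (q * sum λ x → ⟦ κ x Finₚ.≟ x ⟧)))
    det-multipartite = trans step₁ (*-congˡ (trans step₂ (trans step₃
      (*-cong (*-identityˡ _) (trans step₄ det-M₄)))))

-- ℤ[X] as a commutative ring

coeff-+ : ∀ p q k → coeff (p +ᴾ q) k ≡ coeff p k ℤ.+ coeff q k
coeff-+ []      q       k       = ≡.sym (ℤₚ.+-identityˡ _)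
coeff-+ (a ∷ p) []      k       = ≡.sym (ℤₚ.+-identityʳ _)
coeff-+ (a ∷ p) (b ∷ q) zero    = ≡.refl
coeff-+ (a ∷ p) (b ∷ q) (suc k) = coeff-+ p q k

coeff-neg : ∀ p k → coeff (-ᴾ p) k ≡ - coeff p k
coeff-neg []      k       = ≡.refl
coeff-neg (a ∷ p) zero    = ≡.refl
coeff-neg (a ∷ p) (suc k) = coeff-neg p k

coeff-scale : ∀ a p k → coeff (map (a ℤ.*_) p) k ≡ a ℤ.* coeff p k
coeff-scale a []      k       = ≡.sym (ℤₚ.*-zeroʳ a)
coeff-scale a (b ∷ p) zero    = ≡.refl
coeff-scale a (b ∷ p) (suc k) = coeff-scale a p k

coeff-0 : ∀ k → coeff (const 0ℤ) k ≡ 0ℤ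
coeff-0 zero    = ≡.refl
coeff-0 (suc k) = ≡.refl

coeff-∷* : ∀ a p q k → coeff ((a ∷ p) *ᴾ q) k ≡ a ℤ.* coeff q k ℤ.+ coeff (0ℤ ∷ p *ᴾ q) k
coeff-∷* a p q k = ≡.trans (coeff-+ (map (a ℤ.*_) q) (0ℤ ∷ p *ᴾ q) k) (≡.cong (ℤ._+ _) (coeff-scale a q k))

∷-cong : ∀ {a b p q} → a ≡ b → p ≈ᴾ q → a ∷ p ≈ᴾ b ∷ q
∷-cong a≡b p≈q zero    = a≡b
∷-cong a≡b p≈q (suc k) = p≈q k

≈ᴾ-isEquivalence : IsEquivalence _≈ᴾ_
≈ᴾ-isEquivalence = record
  { refl  = λ k → ≡.refl
  ; sym   = λ p≈q k → ≡.sym (p≈q k)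
  ; trans = λ p≈q q≈r k → ≡.trans (p≈q k) (q≈r k)
  }

+ᴾ-cong : ∀ {p p′ q q′} → p ≈ᴾ p′ → q ≈ᴾ q′ → p +ᴾ q ≈ᴾ p′ +ᴾ q′
+ᴾ-cong {p} {p′} {q} {q′} p≈ q≈ k = begin
  coeff (p +ᴾ q) k             ≡⟨ coeff-+ p q k ⟩
  coeff p k ℤ.+ coeff q k      ≡⟨ ≡.cong₂ ℤ._+_ (p≈ k) (q≈ k) ⟩
  coeff p′ k ℤ.+ coeff q′ k    ≡⟨ ≡.sym (coeff-+ p′ q′ k) ⟩
  coeff (p′ +ᴾ q′) k           ∎
  where open ≡.≡-Reasoning

+ᴾ-assoc : ∀ p q r → (p +ᴾ q) +ᴾ r ≈ᴾ p +ᴾ (q +ᴾ r)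
+ᴾ-assoc p q r k = begin
  coeff ((p +ᴾ q) +ᴾ r) k                      ≡⟨ coeff-+ (p +ᴾ q) r k ⟩
  coeff (p +ᴾ q) k ℤ.+ coeff r k               ≡⟨ ≡.cong (ℤ._+ coeff r k) (coeff-+ p q k) ⟩
  coeff p k ℤ.+ coeff q k ℤ.+ coeff r k        ≡⟨ ℤₚ.+-assoc (coeff p k) _ _ ⟩
  coeff p k ℤ.+ (coeff q k ℤ.+ coeff r k)      ≡⟨ ≡.cong (λ x → coeff p k ℤ.+ x) (≡.sym (coeff-+ q r k)) ⟩
  coeff p k ℤ.+ coeff (q +ᴾ r) k               ≡⟨ ≡.sym (coeff-+ p (q +ᴾ r) k) ⟩
  coeff (p +ᴾ (q +ᴾ r)) k                      ∎
  where open ≡.≡-Reasoning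

+ᴾ-comm : ∀ p q → p +ᴾ q ≈ᴾ q +ᴾ p
+ᴾ-comm p q k = ≡.trans (coeff-+ p q k) (≡.trans (ℤₚ.+-comm (coeff p k) _) (≡.sym (coeff-+ q p k)))

+ᴾ-identityˡ : ∀ p → const 0ℤ +ᴾ p ≈ᴾ p
+ᴾ-identityˡ p k = begin
  coeff (const 0ℤ +ᴾ p) k          ≡⟨ coeff-+ (const 0ℤ) p k ⟩
  coeff (const 0ℤ) k ℤ.+ coeff p k ≡⟨ ≡.cong (ℤ._+ coeff p k) (coeff-0 k) ⟩
  0ℤ ℤ.+ coeff p k                 ≡⟨ ℤₚ.+-identityˡ _ ⟩
  coeff p k                        ∎
  where open ≡.≡-Reasoning

-ᴾ-inverseˡ : ∀ p → (-ᴾ p) +ᴾ p ≈ᴾ const 0ℤ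
-ᴾ-inverseˡ p k = begin
  coeff ((-ᴾ p) +ᴾ p) k            ≡⟨ coeff-+ (-ᴾ p) p k ⟩
  coeff (-ᴾ p) k ℤ.+ coeff p k     ≡⟨ ≡.cong (ℤ._+ coeff p k) (coeff-neg p k) ⟩
  - coeff p k ℤ.+ coeff p k        ≡⟨ ℤₚ.+-inverseˡ (coeff p k) ⟩
  0ℤ                               ≡⟨ ≡.sym (coeff-0 k) ⟩
  coeff (const 0ℤ) k               ∎
  where open ≡.≡-Reasoning

-ᴾ-cong : ∀ {p q} → p ≈ᴾ q → -ᴾ p ≈ᴾ -ᴾ q
-ᴾ-cong {p} {q} p≈q k = ≡.trans (coeff-neg p k) (≡.trans (≡.cong -_ (p≈q k)) (≡.sym (coeff-neg q k)))

*ᴾ-zeroʳ : ∀ p → p *ᴾ [] ≈ᴾ []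
*ᴾ-zeroʳ []      k       = ≡.refl
*ᴾ-zeroʳ (a ∷ p) zero    = ≡.refl
*ᴾ-zeroʳ (a ∷ p) (suc k) = *ᴾ-zeroʳ p k

-- Multiplication recurses on its left factor; this is the mirror recursion on the right one, from
-- which commutativity follows by induction.
coeff-*∷ : ∀ p b q k → coeff (p *ᴾ (b ∷ q)) k ≡ b ℤ.* coeff p k ℤ.+ coeff (0ℤ ∷ p *ᴾ q) k
coeff-*∷ []      b q zero    = ≡.sym (≡.trans (ℤₚ.+-identityʳ _) (ℤₚ.*-zeroʳ b))
coeff-*∷ []      b q (suc k) = ≡.sym (≡.trans (ℤₚ.+-identityʳ _) (ℤₚ.*-zeroʳ b))
coeff-*∷ (a ∷ p) b q zero    = ≡.cong (ℤ._+ 0ℤ) (ℤₚ.*-comm a b)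
coeff-*∷ (a ∷ p) b q (suc k) = begin
  coeff (map (a ℤ.*_) q +ᴾ p *ᴾ (b ∷ q)) k
    ≡⟨ coeff-+ (map (a ℤ.*_) q) (p *ᴾ (b ∷ q)) k ⟩
  coeff (map (a ℤ.*_) q) k ℤ.+ coeff (p *ᴾ (b ∷ q)) k
    ≡⟨ ≡.cong₂ ℤ._+_ (coeff-scale a q k) (coeff-*∷ p b q k) ⟩
  a ℤ.* coeff q k ℤ.+ (b ℤ.* coeff p k ℤ.+ coeff (0ℤ ∷ p *ᴾ q) k)
    ≡⟨ exchange (a ℤ.* coeff q k) (b ℤ.* coeff p k) (coeff (0ℤ ∷ p *ᴾ q) k) ⟩
  b ℤ.* coeff p k ℤ.+ (a ℤ.* coeff q k ℤ.+ coeff (0ℤ ∷ p *ᴾ q) k)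
    ≡⟨ ≡.cong (λ x → b ℤ.* coeff p k ℤ.+ x) (≡.sym (coeff-∷* a p q k)) ⟩
  b ℤ.* coeff p k ℤ.+ coeff ((a ∷ p) *ᴾ q) k ∎
  where
  open ≡.≡-Reasoning
  exchange : ∀ x y z → x ℤ.+ (y ℤ.+ z) ≡ y ℤ.+ (x ℤ.+ z)
  exchange = solve-∀

*ᴾ-comm : ∀ p q → p *ᴾ q ≈ᴾ q *ᴾ p
*ᴾ-comm []      q k = ≡.sym (*ᴾ-zeroʳ q k)
*ᴾ-comm (a ∷ p) q k = begin
  coeff ((a ∷ p) *ᴾ q) k                      ≡⟨ coeff-∷* a p q k ⟩
  a ℤ.* coeff q k ℤ.+ coeff (0ℤ ∷ p *ᴾ q) k   ≡⟨ ≡.cong (λ x → a ℤ.* coeff q k ℤ.+ x) (∷-cong {p = p *ᴾ q} ≡.refl (*ᴾ-comm p q) k) ⟩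
  a ℤ.* coeff q k ℤ.+ coeff (0ℤ ∷ q *ᴾ p) k   ≡⟨ ≡.sym (coeff-*∷ q a p k) ⟩
  coeff (q *ᴾ (a ∷ p)) k                      ∎
  where open ≡.≡-Reasoning

*ᴾ-congˡ : ∀ p {q r} → q ≈ᴾ r → p *ᴾ q ≈ᴾ p *ᴾ r
*ᴾ-congˡ []      q≈r k = ≡.refl
*ᴾ-congˡ (a ∷ p) {q} {r} q≈r k = begin
  coeff ((a ∷ p) *ᴾ q) k                      ≡⟨ coeff-∷* a p q k ⟩
  a ℤ.* coeff q k ℤ.+ coeff (0ℤ ∷ p *ᴾ q) k   ≡⟨ ≡.cong₂ (λ x y → a ℤ.* x ℤ.+ y) (q≈r k) (∷-cong {p = p *ᴾ q} ≡.refl (*ᴾ-congˡ p q≈r) k) ⟩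
  a ℤ.* coeff r k ℤ.+ coeff (0ℤ ∷ p *ᴾ r) k   ≡⟨ ≡.sym (coeff-∷* a p r k) ⟩
  coeff ((a ∷ p) *ᴾ r) k                      ∎
  where open ≡.≡-Reasoning

-- Equal polynomials may be lists of different lengths, which obstructs an induction on the left
-- factor. That factor is moved to the right by commutativity and replaced there.
*ᴾ-cong : ∀ {p p′ q q′} → p ≈ᴾ p′ → q ≈ᴾ q′ → p *ᴾ q ≈ᴾ p′ *ᴾ q′
*ᴾ-cong {p} {p′} {q} {q′} p≈ q≈ k = begin
  coeff (p *ᴾ q) k   ≡⟨ *ᴾ-congˡ p q≈ k ⟩
  coeff (p *ᴾ q′) k  ≡⟨ *ᴾ-comm p q′ k ⟩
  coeff (q′ *ᴾ p) k  ≡⟨ *ᴾ-congˡ q′ p≈ k ⟩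
  coeff (q′ *ᴾ p′) k ≡⟨ *ᴾ-comm q′ p′ k ⟩
  coeff (p′ *ᴾ q′) k ∎
  where open ≡.≡-Reasoning

*ᴾ-distribˡ : ∀ p q r → p *ᴾ (q +ᴾ r) ≈ᴾ p *ᴾ q +ᴾ p *ᴾ r
*ᴾ-distribˡ []      q r k = ≡.refl
*ᴾ-distribˡ (a ∷ p) q r k = begin
  coeff ((a ∷ p) *ᴾ (q +ᴾ r)) k
    ≡⟨ coeff-∷* a p (q +ᴾ r) k ⟩
  a ℤ.* coeff (q +ᴾ r) k ℤ.+ coeff (0ℤ ∷ p *ᴾ (q +ᴾ r)) k
    ≡⟨ ≡.cong₂ (λ x y → a ℤ.* x ℤ.+ y) (coeff-+ q r k)
         (≡.trans (∷-cong {p = p *ᴾ (q +ᴾ r)} ≡.refl (*ᴾ-distribˡ p q r) k)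
                  (coeff-+ (0ℤ ∷ p *ᴾ q) (0ℤ ∷ p *ᴾ r) k)) ⟩
  a ℤ.* (coeff q k ℤ.+ coeff r k) ℤ.+ (coeff (0ℤ ∷ p *ᴾ q) k ℤ.+ coeff (0ℤ ∷ p *ᴾ r) k)
    ≡⟨ regroup a (coeff q k) (coeff r k) _ _ ⟩
  (a ℤ.* coeff q k ℤ.+ coeff (0ℤ ∷ p *ᴾ q) k) ℤ.+ (a ℤ.* coeff r k ℤ.+ coeff (0ℤ ∷ p *ᴾ r) k)
    ≡⟨ ≡.sym (≡.cong₂ ℤ._+_ (coeff-∷* a p q k) (coeff-∷* a p r k)) ⟩
  coeff ((a ∷ p) *ᴾ q) k ℤ.+ coeff ((a ∷ p) *ᴾ r) k
    ≡⟨ ≡.sym (coeff-+ ((a ∷ p) *ᴾ q) ((a ∷ p) *ᴾ r) k) ⟩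
  coeff ((a ∷ p) *ᴾ q +ᴾ (a ∷ p) *ᴾ r) k ∎
  where
  open ≡.≡-Reasoning
  regroup : ∀ a x y z w → a ℤ.* (x ℤ.+ y) ℤ.+ (z ℤ.+ w) ≡ (a ℤ.* x ℤ.+ z) ℤ.+ (a ℤ.* y ℤ.+ w)
  regroup = solve-∀

*ᴾ-distribʳ : ∀ p q r → (q +ᴾ r) *ᴾ p ≈ᴾ q *ᴾ p +ᴾ r *ᴾ p
*ᴾ-distribʳ p q r k = ≡.trans (*ᴾ-comm (q +ᴾ r) p k) (≡.trans (*ᴾ-distribˡ p q r k)
  (+ᴾ-cong {p *ᴾ q} {q *ᴾ p} {p *ᴾ r} {r *ᴾ p} (*ᴾ-comm p q) (*ᴾ-comm p r) k))

0∷-*ᴾ : ∀ p q → (0ℤ ∷ p) *ᴾ q ≈ᴾ 0ℤ ∷ p *ᴾ q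
0∷-*ᴾ p q k = ≡.trans (coeff-∷* 0ℤ p q k) (ℤₚ.+-identityˡ _)

scale-*ᴾ : ∀ a p q → map (a ℤ.*_) p *ᴾ q ≈ᴾ map (a ℤ.*_) (p *ᴾ q)
scale-*ᴾ a []      q k = ≡.refl
scale-*ᴾ a (b ∷ p) q k = begin
  coeff ((a ℤ.* b ∷ map (a ℤ.*_) p) *ᴾ q) k
    ≡⟨ coeff-∷* (a ℤ.* b) (map (a ℤ.*_) p) q k ⟩
  a ℤ.* b ℤ.* coeff q k ℤ.+ coeff (0ℤ ∷ map (a ℤ.*_) p *ᴾ q) k
    ≡⟨ ≡.cong₂ ℤ._+_ (ℤₚ.*-assoc a b _) (shift k) ⟩
  a ℤ.* (b ℤ.* coeff q k) ℤ.+ a ℤ.* coeff (0ℤ ∷ p *ᴾ q) k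
    ≡⟨ ≡.sym (ℤₚ.*-distribˡ-+ a _ _) ⟩
  a ℤ.* (b ℤ.* coeff q k ℤ.+ coeff (0ℤ ∷ p *ᴾ q) k)
    ≡⟨ ≡.cong (a ℤ.*_) (≡.sym (coeff-∷* b p q k)) ⟩
  a ℤ.* coeff ((b ∷ p) *ᴾ q) k
    ≡⟨ ≡.sym (coeff-scale a ((b ∷ p) *ᴾ q) k) ⟩
  coeff (map (a ℤ.*_) ((b ∷ p) *ᴾ q)) k ∎
  where
  open ≡.≡-Reasoning
  shift : ∀ k → coeff (0ℤ ∷ map (a ℤ.*_) p *ᴾ q) k ≡ a ℤ.* coeff (0ℤ ∷ p *ᴾ q) k
  shift zero    = ≡.sym (ℤₚ.*-zeroʳ a)
  shift (suc k) = ≡.trans (scale-*ᴾ a p q k) (coeff-scale a (p *ᴾ q) k)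

*ᴾ-assoc : ∀ p q r → (p *ᴾ q) *ᴾ r ≈ᴾ p *ᴾ (q *ᴾ r)
*ᴾ-assoc []      q r k = ≡.refl
*ᴾ-assoc (a ∷ p) q r k = begin
  coeff ((map (a ℤ.*_) q +ᴾ (0ℤ ∷ p *ᴾ q)) *ᴾ r) k
    ≡⟨ *ᴾ-distribʳ r (map (a ℤ.*_) q) (0ℤ ∷ p *ᴾ q) k ⟩
  coeff (map (a ℤ.*_) q *ᴾ r +ᴾ (0ℤ ∷ p *ᴾ q) *ᴾ r) k
    ≡⟨ +ᴾ-cong {map (a ℤ.*_) q *ᴾ r} {map (a ℤ.*_) (q *ᴾ r)} {(0ℤ ∷ p *ᴾ q) *ᴾ r} {0ℤ ∷ p *ᴾ (q *ᴾ r)}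
         (scale-*ᴾ a q r)
         (λ i → ≡.trans (0∷-*ᴾ (p *ᴾ q) r i) (∷-cong {p = (p *ᴾ q) *ᴾ r} ≡.refl (*ᴾ-assoc p q r) i)) k ⟩
  coeff (map (a ℤ.*_) (q *ᴾ r) +ᴾ (0ℤ ∷ p *ᴾ (q *ᴾ r))) k ∎
  where open ≡.≡-Reasoning

*ᴾ-identityˡ : ∀ p → const 1ℤ *ᴾ p ≈ᴾ p
*ᴾ-identityˡ p k = begin
  coeff (const 1ℤ *ᴾ p) k                    ≡⟨ coeff-∷* 1ℤ [] p k ⟩
  1ℤ ℤ.* coeff p k ℤ.+ coeff (const 0ℤ) k    ≡⟨ ≡.cong₂ ℤ._+_ (ℤₚ.*-identityˡ (coeff p k)) (coeff-0 k) ⟩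
  coeff p k ℤ.+ 0ℤ                           ≡⟨ ℤₚ.+-identityʳ _ ⟩
  coeff p k                                  ∎
  where open ≡.≡-Reasoning

ℤ[X]-isCommutativeRing : IsCommutativeRing _≈ᴾ_ _+ᴾ_ _*ᴾ_ -ᴾ_ (const 0ℤ) (const 1ℤ)
ℤ[X]-isCommutativeRing = record
  { isRing = record
    { +-isAbelianGroup = record
      { isGroup = record
        { isMonoid = record
          { isSemigroup = record
            { isMagma = record
              { isEquivalence = ≈ᴾ-isEquivalence
              ; ∙-cong        = λ {p} {p′} {q} {q′} → +ᴾ-cong {p} {p′} {q} {q′}
              }
            ; assoc = +ᴾ-assoc
            }
          ; identity = +ᴾ-identityˡ , λ p k → ≡.trans (+ᴾ-comm p (const 0ℤ) k) (+ᴾ-identityˡ p k)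
          }
        ; inverse = -ᴾ-inverseˡ , λ p k → ≡.trans (+ᴾ-comm p (-ᴾ p) k) (-ᴾ-inverseˡ p k)
        ; ⁻¹-cong = λ {p} {q} → -ᴾ-cong {p} {q}
        }
      ; comm = +ᴾ-comm
      }
    ; *-cong     = λ {p} {p′} {q} {q′} → *ᴾ-cong {p} {p′} {q} {q′}
    ; *-assoc    = *ᴾ-assoc
    ; *-identity = *ᴾ-identityˡ , λ p k → ≡.trans (*ᴾ-comm p (const 1ℤ) k) (*ᴾ-identityˡ p k)
    ; distrib    = *ᴾ-distribˡ , *ᴾ-distribʳ
    }
  ; *-comm = *ᴾ-comm
  }

ℤ[X]-commutativeRing : CommutativeRing 0ℓ 0ℓ
ℤ[X]-commutativeRing = record { isCommutativeRing = ℤ[X]-isCommutativeRing }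

-- Residue classes modulo p: their sizes and the resulting exponents

module ResidueClasses (R : CommutativeRing 0ℓ 0ℓ) where
  open CommutativeRing R hiding (zero; -_; _-_)
  open Determinant rawRing
  open RawSemiringDefs (Semiring.rawSemiring semiring) using (product) renaming (_×_ to _·_)
  open SemiringSum semiring using (sum; sum-cong-≋; sum-replicate)
  open MonoidSum *-monoid using () renaming (sum-cong-≋ to product-cong; sum-replicate-zero to product-replicate-one)
  open DeterminantProperties R
  open Multipartite R
  open SetoidReasoning setoid

  sum-periodic : ∀ p Q (g : ℕ → Carrier) → (∀ i → g (p ℕ.+ i) ≡ g i) →
                 sum {Q ℕ.* p} (g ∘ toℕ) ≈ Q · sum {p} (g ∘ toℕ)
  sum-periodic p zero    g per = refl
  sum-periodic p (suc Q) g per = begin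
    sum {p ℕ.+ Q ℕ.* p} (g ∘ toℕ)
      ≈⟨ sum-split +-monoid p (Q ℕ.* p) g ⟩
    sum {p} (g ∘ toℕ) + sum {Q ℕ.* p} (λ i → g (p ℕ.+ toℕ i))
      ≈⟨ +-congˡ (sum-cong-≋ {Q ℕ.* p} {x = λ i → g (p ℕ.+ toℕ i)} {y = g ∘ toℕ} λ i → reflexive (per (toℕ i))) ⟩
    sum {p} (g ∘ toℕ) + sum {Q ℕ.* p} (g ∘ toℕ)
      ≈⟨ +-congˡ (sum-periodic p Q g per) ⟩
    sum {p} (g ∘ toℕ) + Q · sum {p} (g ∘ toℕ) ∎
  
  module _ (p-1 Q k : ℕ) (t : Carrier) (n≡pQ : suc k ≡ suc p-1 ℕ.* Q) where
    private
      n = suc k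
      p = suc p-1

      κ : Fin n → Fin n
      κ x = fromℕ< (ℕₚ.≤-<-trans (m%n≤m (toℕ x) p) (toℕ<n x))

      toℕ-κ : ∀ x → toℕ (κ x) ≡ toℕ x % p
      toℕ-κ x = toℕ-fromℕ< (ℕₚ.≤-<-trans (m%n≤m (toℕ x) p) (toℕ<n x))

      κ-≤ : ∀ x → κ x Fin.≤ x
      κ-≤ x = ℕₚ.≤-trans (ℕₚ.≤-reflexive (toℕ-κ x)) (m%n≤m (toℕ x) p)

      κ-fixed⇒< : ∀ {x} → κ x ≡ x → toℕ x < p
      κ-fixed⇒< {x} κx≡x = ≡.subst (_< p) (≡.trans (≡.sym (toℕ-κ x)) (≡.cong toℕ κx≡x)) (m%n<n (toℕ x) p)

      <⇒κ-fixed : ∀ {x} → toℕ x < p → κ x ≡ x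
      <⇒κ-fixed {x} x<p = toℕ-injective (≡.trans (toℕ-κ x) (m<n⇒m%n≡m x<p))

      κ-idem : ∀ x → κ (κ x) ≡ κ x
      κ-idem x = <⇒κ-fixed (≡.subst (_< p) (≡.sym (toℕ-κ x)) (m%n<n (toℕ x) p))

      q : Carrier
      q = Q · 1#

      n≡Qp : n ≡ Q ℕ.* p
      n≡Qp = ≡.trans n≡pQ (ℕₚ.*-comm p Q)

      p≤n : p ≤ n
      p≤n = ∣⇒≤ (divides Q n≡Qp)

      n≡p+[n∸p] : n ≡ p ℕ.+ (n ∸ p)
      n≡p+[n∸p] = ≡.sym (ℕₚ.m+[n∸m]≡n p≤n)

      -- Membership in a class is periodic with period `p`, the range 0, ..., n - 1 consists of `Q`
      -- periods, and each period meets the class exactly once.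
      classSize : ∀ z → κ z ≡ z → sum (λ x → δ (κ x) z) ≈ q
      classSize z κz≡z = begin
        sum (λ x → δ (κ x) z)
          ≈⟨ sum-cong-≋ {x = λ x → δ (κ x) z} {y = g ∘ toℕ} (λ x → reflexive (if-does (κ x Finₚ.≟ z) (toℕ x % p ℕₚ.≟ toℕ z)
               (λ { ≡.refl → ≡.sym (toℕ-κ x) }) (λ eq → toℕ-injective (≡.trans (toℕ-κ x) eq)))) ⟩
        sum {n} (g ∘ toℕ)
          ≈⟨ reflexive (≡.cong (λ m → sum {m} (g ∘ toℕ)) n≡Qp) ⟩
        sum {Q ℕ.* p} (g ∘ toℕ)
          ≈⟨ sum-periodic p Q g (λ i → ≡.cong (λ j → ⟦ j ℕₚ.≟ toℕ z ⟧)
               (≡.trans (≡.cong (_% p) (ℕₚ.+-comm p i)) ([m+n]%n≡m%n i p))) ⟩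
        Q · sum {p} (g ∘ toℕ)
          ≈⟨ ·-cong Q period ⟩
        q ∎
        where
        g : ℕ → Carrier
        g i = ⟦ i % p ℕₚ.≟ toℕ z ⟧
        z<p = κ-fixed⇒< κz≡z
        z′ : Fin p
        z′ = fromℕ< z<p
        ·-cong : ∀ j {a b} → a ≈ b → j · a ≈ j · b
        ·-cong zero    a≈b = refl
        ·-cong (suc j) a≈b = +-cong a≈b (·-cong j a≈b)
        period : sum {p} (g ∘ toℕ) ≈ 1#
        period = begin
          sum {p} (g ∘ toℕ)
            ≈⟨ sum-cong-≋ {x = g ∘ toℕ} {y = λ i → 1# * δ i z′} (λ i → trans (reflexive (if-does (toℕ i % p ℕₚ.≟ toℕ z) (i Finₚ.≟ z′)
                 (λ eq → toℕ-injective (≡.trans (≡.sym (m<n⇒m%n≡m (toℕ<n i))) (≡.trans eq (≡.sym (toℕ-fromℕ< z<p)))))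
                 (λ eq → ≡.trans (m<n⇒m%n≡m (toℕ<n i)) (≡.trans (≡.cong toℕ eq) (toℕ-fromℕ< z<p))))) (sym (*-identityˡ _))) ⟩
          sum {p} (λ i → 1# * δ i z′)
            ≈⟨ sum-δ′ z′ (λ _ → 1#) ⟩
          1# ∎

      -- The fixed points of `κ` are the vertices below `p`, so here, as for the two products that
      -- follow, counting amounts to cutting the range at a threshold.
      fixedCount : sum (λ x → ⟦ κ x Finₚ.≟ x ⟧) ≈ p · 1#
      fixedCount = begin
        sum (λ x → ⟦ κ x Finₚ.≟ x ⟧)
          ≈⟨ sum-cong-≋ {x = λ x → ⟦ κ x Finₚ.≟ x ⟧} {y = g ∘ toℕ} (λ x →
               reflexive (if-does (κ x Finₚ.≟ x) (toℕ x ℕₚ.<? p) κ-fixed⇒< <⇒κ-fixed)) ⟩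
        sum {n} (g ∘ toℕ)
          ≈⟨ reflexive (≡.cong (λ m → sum {m} (g ∘ toℕ)) n≡p+[n∸p]) ⟩
        sum {p ℕ.+ (n ∸ p)} (g ∘ toℕ)
          ≈⟨ sum-threshold +-monoid p (n ∸ p) 1# 0# ⟩
        sum {p} (λ _ → 1#) + sum {n ∸ p} (λ _ → 0#)
          ≈⟨ +-cong (sum-replicate p) (sum-zero {f = λ (_ : Fin (n ∸ p)) → 0#} λ _ → refl) ⟩
        p · 1# + 0#
          ≈⟨ +-identityʳ (p · 1#) ⟩
        p · 1# ∎
        where
        g : ℕ → Carrier
        g i = ⟦ i ℕₚ.<? p ⟧

      nonRepresentatives : product (λ x → if does (κ x Finₚ.≟ x) then 1# else t) ≈ product {n ∸ p} (λ _ → t)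
      nonRepresentatives = begin
        product (λ x → if does (κ x Finₚ.≟ x) then 1# else t)
          ≈⟨ product-cong {x = λ x → if does (κ x Finₚ.≟ x) then 1# else t} {y = g ∘ toℕ} (λ x →
               reflexive (if-does (κ x Finₚ.≟ x) (toℕ x ℕₚ.<? p) κ-fixed⇒< <⇒κ-fixed)) ⟩
        product {n} (g ∘ toℕ)
          ≈⟨ reflexive (≡.cong (λ m → product {m} (g ∘ toℕ)) n≡p+[n∸p]) ⟩
        product {p ℕ.+ (n ∸ p)} (g ∘ toℕ)
          ≈⟨ sum-threshold *-monoid p (n ∸ p) 1# t ⟩
        product {p} (λ _ → 1#) * product {n ∸ p} (λ _ → t)
          ≈⟨ *-congʳ (product-replicate-one p) ⟩
        1# * product {n ∸ p} (λ _ → t)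
          ≈⟨ *-identityˡ _ ⟩
        product {n ∸ p} (λ _ → t) ∎
        where
        g : ℕ → Carrier
        g i = if does (i ℕₚ.<? p) then 1# else t

      nonzeroRepresentatives : product (λ x → if does (κ (suc x) Finₚ.≟ suc x) then t + q else 1#) ≈
                               product {p-1} (λ _ → t + q)
      nonzeroRepresentatives = begin
        product (λ x → if does (κ (suc x) Finₚ.≟ suc x) then t + q else 1#)
          ≈⟨ product-cong {x = λ x → if does (κ (suc x) Finₚ.≟ suc x) then t + q else 1#} {y = g ∘ toℕ} (λ x →
               reflexive (if-does (κ (suc x) Finₚ.≟ suc x) (toℕ x ℕₚ.<? p-1)
                 (ℕ.s<s⁻¹ ∘ κ-fixed⇒<) (<⇒κ-fixed ∘ ℕ.s<s))) ⟩
        product {k} (g ∘ toℕ)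
          -- The index runs over predecessors of vertices, so the bound and the threshold both drop
          -- by one: k = (p - 1) + (n - p).
          ≈⟨ reflexive (≡.cong (λ m → product {m} (g ∘ toℕ)) (ℕₚ.suc-injective n≡p+[n∸p])) ⟩
        product {p-1 ℕ.+ (n ∸ p)} (g ∘ toℕ)
          ≈⟨ sum-threshold *-monoid p-1 (n ∸ p) (t + q) 1# ⟩
        product {p-1} (λ _ → t + q) * product {n ∸ p} (λ _ → 1#)
          ≈⟨ *-congˡ (product-replicate-one (n ∸ p)) ⟩
        product {p-1} (λ _ → t + q) * 1#
          ≈⟨ *-identityʳ _ ⟩
        product {p-1} (λ _ → t + q) ∎
        where
        g : ℕ → Carrier
        g i = if does (i ℕₚ.<? p-1) then t + q else 1#

    -- `factor` stands for θ ↦ X - θ. The ring is still arbitrary here, so the values of `factor` at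
    -- the three eigenvalues are supplied as hypotheses, to be checked in `ℤ[X]` later.
    det-residueClasses : ∀ {M : Matrix Carrier n} (factor : ℤ → Carrier) →
      (∀ x y → M x y ≈ t * δ x y + -1# * ⟦ ¬? (toℕ x % p ℕₚ.≟ toℕ y % p) ⟧) →
      factor (+ n - + Q) ≈ t + Q · 1# + -1# * (Q · 1# * p · 1#) →
      factor 0ℤ ≈ t → factor (- + Q) ≈ t + Q · 1# →
      det M ≈ foldr (λ θ r → factor θ * r) 1# ([ + n - + Q ] ++ replicate (n ∸ p) 0ℤ ++ replicate p-1 (- + Q))
    det-residueClasses {M} factor M≈ degree≈ zero≈ negative≈ = begin
      det M
        ≈⟨ det-cong (λ x y → trans (M≈ x y) (+-congˡ (*-congˡ (reflexive (if-does (¬? (toℕ x % p ℕₚ.≟ toℕ y % p)) (¬? (κ x Finₚ.≟ κ y))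
             (λ x≢y κx≡κy → x≢y (≡.trans (≡.sym (toℕ-κ x)) (≡.trans (≡.cong toℕ κx≡κy) (toℕ-κ y))))
             (λ κx≢κy x≡y → κx≢κy (toℕ-injective (≡.trans (toℕ-κ x) (≡.trans x≡y (≡.sym (toℕ-κ y))))))))))) ⟩
      det (λ x y → t * δ x y + -1# * ⟦ ¬? (κ x Finₚ.≟ κ y) ⟧)
        ≈⟨ det-multipartite κ κ-idem κ-≤ t q classSize ⟩
      product (λ x → if does (κ x Finₚ.≟ x) then 1# else t) *
      (product (λ x → if does (κ (suc x) Finₚ.≟ suc x) then t + q else 1#) *
       (t + q + -1# * (q * sum λ x → ⟦ κ x Finₚ.≟ x ⟧)))
        ≈⟨ *-cong nonRepresentatives (*-cong nonzeroRepresentatives (+-congˡ (*-congˡ (*-congˡ fixedCount)))) ⟩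
      zeros * (negatives * (t + q + -1# * (q * p · 1#)))
        ≈⟨ trans (sym (*-assoc _ _ _)) (*-comm _ _) ⟩
      (t + q + -1# * (q * p · 1#)) * (zeros * negatives)
        ≈⟨ *-cong (sym degree≈) (*-congˡ (sym (*-identityʳ _))) ⟩
      factor (+ n - + Q) * (zeros * (negatives * 1#))
        ≈⟨ *-congˡ (sym (trans (factors-replicate (n ∸ p) 0ℤ (replicate p-1 (- + Q)) zero≈) (*-congˡ (trans
             (reflexive (≡.cong factors (≡.sym (++-identityʳ (replicate p-1 (- + Q))))))
             (factors-replicate p-1 (- + Q) [] negative≈))))) ⟩
      factor (+ n - + Q) * factors (replicate (n ∸ p) 0ℤ ++ replicate p-1 (- + Q)) ∎
      where
      zeros negatives : Carrier
      zeros     = product {n ∸ p} (λ _ → t)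
      negatives = product {p-1} (λ _ → t + q)
      factors : List ℤ → Carrier
      factors = foldr (λ θ r → factor θ * r) 1#
      factors-replicate : ∀ j θ θs {f} → factor θ ≈ f →
        factors (replicate j θ ++ θs) ≈ product {j} (λ _ → f) * factors θs
      factors-replicate zero    θ θs eq = sym (*-identityˡ _)
      factors-replicate (suc j) θ θs eq = trans (*-cong eq (factors-replicate j θ θs eq)) (sym (*-assoc _ _ _))

-- Characteristic polynomials in ℤ[X]

module _ where
  private
    module P = CommutativeRing ℤ[X]-commutativeRing
  open P using (_≈_; _+_; _*_; 1#)
  open RawSemiringDefs (Semiring.rawSemiring P.semiring) using () renaming (_×_ to _·_)
  open DeterminantProperties ℤ[X]-commutativeRing using (-1#)
  open Multipartite ℤ[X]-commutativeRing using (⟦_⟧)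
  open ResidueClasses ℤ[X]-commutativeRing using (det-residueClasses)

  const-· : ∀ j → j · 1# ≡ const (+ j)
  const-· zero    = ≡.refl
  const-· (suc j) = ≡.cong (λ r → 1# + r) (const-· j)

  -- In each of the four cases both sides are explicit lists, possibly with different trailing
  -- zeros; hence the comparison by coefficients in degree 0, in degree 1 and beyond.
  characteristicEntry : ∀ {P E : Set} (P? : Dec P) (E? : Dec E) {a} → a ≡ (if does E? then 0ℤ else 1ℤ) →
    (if does P? then X else const 0ℤ) -ᴾ const a ≈ X * ⟦ P? ⟧ + -1# * ⟦ ¬? E? ⟧
  characteristicEntry P? E? ≡.refl with does P? | does E?
  ... | true  | true  = λ { zero → ≡.refl ; (suc zero) → ≡.refl ; (suc (suc k)) → ≡.refl }
  ... | true  | false = λ { zero → ≡.refl ; (suc zero) → ≡.refl ; (suc (suc k)) → ≡.refl }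
  ... | false | true  = λ { zero → ≡.refl ; (suc zero) → ≡.refl ; (suc (suc k)) → ≡.refl }
  ... | false | false = λ { zero → ≡.refl ; (suc zero) → ≡.refl ; (suc (suc k)) → ≡.refl }

  -- Only the constant coefficient has content: -(pQ - Q) = Q - Qp. The stray zeros in `expand` are
  -- what list addition and multiplication leave behind when they unfold.
  degreeFactor : ∀ p Q n → n ≡ p ℕ.* Q → X -ᴾ const (+ n - + Q) ≈ X + Q · 1# + -1# * (Q · 1# * p · 1#)
  degreeFactor p Q n n≡pQ rewrite const-· p | const-· Q = λ
    { zero          → ≡.trans (≡.cong (λ a → 0ℤ ℤ.+ - (a - + Q)) (≡.trans (≡.cong +_ n≡pQ) (ℤₚ.pos-* p Q)))
                              (expand (+ p) (+ Q))
    ; (suc zero)    → ≡.refl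
    ; (suc (suc k)) → ≡.refl
    }
    where
    expand : ∀ a b → 0ℤ ℤ.+ - (a ℤ.* b - b) ≡ 0ℤ ℤ.+ b ℤ.+ (- 1ℤ ℤ.* (b ℤ.* a ℤ.+ 0ℤ) ℤ.+ 0ℤ)
    expand = solve-∀

  residueClasses-spectrum : ∀ p Q n .{{_ : NonZero p}} .{{_ : NonZero n}} → n ≡ p ℕ.* Q → (A : Matrix ℤ n) →
    (∀ x y → A x y ≡ (if does (toℕ x % p ℕₚ.≟ toℕ y % p) then 0ℤ else 1ℤ)) →
    HasSpectrum A ([ + n - + Q ] ++ replicate (n ∸ p) (+ 0) ++ replicate (p ∸ 1) (- + Q))
  residueClasses-spectrum (suc p-1) Q (suc k) n≡pQ A A≡ =
    det-residueClasses p-1 Q k X n≡pQ {λ x y → (if does (x Finₚ.≟ y) then X else const 0ℤ) -ᴾ const (A x y)}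
      (λ θ → X -ᴾ const θ)
      (λ x y → characteristicEntry (x Finₚ.≟ y) (toℕ x % suc p-1 ℕₚ.≟ toℕ y % suc p-1) (A≡ x y))
      (degreeFactor (suc p-1) Q (suc k) n≡pQ)
      (P.+-identityʳ X)
      (P.reflexive (≡.cong (λ r → X + r) (≡.trans (≡.cong const (ℤₚ.neg-involutive (+ Q))) (≡.sym (const-· Q)))))

-- Coprimality to a prime power as non-congruence modulo the prime

-- A common divisor `d` of `w` and p·p^m is coprime to `p`: a shared divisor is 1 or `p`, and `p`
-- would divide `w`. So `p` can be cancelled and `d` divides p^m, where the induction hypothesis
-- applies.
prime∤⇒coprime : ∀ {p} → Prime p → ∀ {w} → ¬ p ∣ w → ∀ m → Coprime w (p ^ m)
prime∤⇒coprime p-prime p∤w zero    (_ , d∣1) = ∣1⇒≡1 d∣1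
prime∤⇒coprime {p} p-prime p∤w (suc m) {d} (d∣w , d∣p*pᵐ) =
  prime∤⇒coprime p-prime p∤w m (d∣w , coprime-divisor d⊥p d∣p*pᵐ)
  where
  d⊥p : Coprime d p
  d⊥p (e∣d , e∣p) with prime⇒irreducible p-prime e∣p
  ... | inj₁ e≡1    = e≡1
  ... | inj₂ ≡.refl = contradiction (∣-trans e∣d d∣w) p∤w

module _ (p n : ℕ) .{{_ : NonZero p}} .{{_ : NonZero n}} (p∣n : p ∣ n) where
  open FiniteGroup (ℤₙ n) using (_∙_; _⁻¹)

  -- Both group operations reduce modulo `n`, which is invisible modulo a divisor of `n`. The
  -- natural number `n ∸ toℕ x` represents -x.
  [-x+y]%p : ∀ x y → toℕ (x ⁻¹ ∙ y) % p ≡ (n ∸ toℕ x ℕ.+ toℕ y) % p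
  [-x+y]%p x y = begin
    toℕ (x ⁻¹ ∙ y) % p
      ≡⟨ ≡.cong (_% p) (toℕ-fromℕ< (m%n<n (toℕ (x ⁻¹) ℕ.+ toℕ y) n)) ⟩
    (toℕ (x ⁻¹) ℕ.+ toℕ y) % n % p
      ≡⟨ m∣n⇒o%n%m≡o%m p n _ p∣n ⟩
    (toℕ (x ⁻¹) ℕ.+ toℕ y) % p
      ≡⟨ %-distribˡ-+ (toℕ (x ⁻¹)) (toℕ y) p ⟩
    (toℕ (x ⁻¹) % p ℕ.+ toℕ y % p) % p
      ≡⟨ ≡.cong (λ a → (a ℕ.+ toℕ y % p) % p)
           (≡.trans (≡.cong (_% p) (toℕ-fromℕ< (m%n<n (n ∸ toℕ x) n))) (m∣n⇒o%n%m≡o%m p n _ p∣n)) ⟩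
    ((n ∸ toℕ x) % p ℕ.+ toℕ y % p) % p
      ≡⟨ ≡.sym (%-distribˡ-+ (n ∸ toℕ x) (toℕ y) p) ⟩
    (n ∸ toℕ x ℕ.+ toℕ y) % p ∎
    where open ≡.≡-Reasoning

  ∣⇒congruent : ∀ x y → p ∣ toℕ (x ⁻¹ ∙ y) → toℕ x % p ≡ toℕ y % p
  ∣⇒congruent x y p∣ = begin
    toℕ x % p
      ≡⟨ ≡.sym (%-remove-+ʳ (toℕ x) (m%n≡0⇒n∣m (n ∸ toℕ x ℕ.+ toℕ y) p
           (≡.trans (≡.sym ([-x+y]%p x y)) (n∣m⇒m%n≡0 (toℕ (x ⁻¹ ∙ y)) p p∣)))) ⟩
    (toℕ x ℕ.+ (n ∸ toℕ x ℕ.+ toℕ y)) % p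
      ≡⟨ ≡.cong (_% p) (≡.trans (≡.sym (ℕₚ.+-assoc (toℕ x) _ _)) (≡.cong (ℕ._+ toℕ y) (ℕₚ.m+[n∸m]≡n (Finₚ.toℕ≤n x)))) ⟩
    (n ℕ.+ toℕ y) % p
      ≡⟨ %-remove-+ˡ (toℕ y) p∣n ⟩
    toℕ y % p ∎
    where open ≡.≡-Reasoning

  congruent⇒∣ : ∀ x y → toℕ x % p ≡ toℕ y % p → p ∣ toℕ (x ⁻¹ ∙ y)
  congruent⇒∣ x y x≡y = m%n≡0⇒n∣m (toℕ (x ⁻¹ ∙ y)) p (begin
    toℕ (x ⁻¹ ∙ y) % p
      ≡⟨ [-x+y]%p x y ⟩
    (n ∸ toℕ x ℕ.+ toℕ y) % p
      ≡⟨ %-distribˡ-+ (n ∸ toℕ x) (toℕ y) p ⟩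
    ((n ∸ toℕ x) % p ℕ.+ toℕ y % p) % p
      ≡⟨ ≡.cong (λ a → ((n ∸ toℕ x) % p ℕ.+ a) % p) (≡.sym x≡y) ⟩
    ((n ∸ toℕ x) % p ℕ.+ toℕ x % p) % p
      ≡⟨ ≡.sym (%-distribˡ-+ (n ∸ toℕ x) (toℕ x) p) ⟩
    (n ∸ toℕ x ℕ.+ toℕ x) % p
      ≡⟨ ≡.cong (_% p) (ℕₚ.m∸n+n≡m (Finₚ.toℕ≤n x)) ⟩
    n % p
      ≡⟨ n∣m⇒m%n≡0 n p p∣n ⟩
    0 ∎)
    where open ≡.≡-Reasoning

-- With `w` the residue of y - x: if `x` and `y` are congruent, `p` divides both `w` and `n`, so a
-- gcd of 1 would force `p` to be 1; otherwise `w` is coprime to every power of `p`. The decision is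
-- an argument of `go`, so splitting on it leaves the test on the gcd untouched.
adjacency-congruence : ∀ {p} m (p-prime : Prime p) →
  let instance
        _ : NonZero p
        _ = prime⇒nonZero p-prime
        _ : NonZero (p ^ suc m)
        _ = primePower-nonZero p-prime (suc m)
        _ : NonTrivial (p ^ suc m)
        _ = primePower-nonTrivial p-prime {suc m} (s≤s z≤n)
  in ∀ x y → adjacencyMatrix (Cay (ℤₙ (p ^ suc m)) (coprimeResidues (p ^ suc m))) x y ≡
             (if does (toℕ x % p ℕₚ.≟ toℕ y % p) then 0ℤ else 1ℤ)
adjacency-congruence {p} m p-prime x y = go (toℕ x % p ℕₚ.≟ toℕ y % p)
  where
  instance
    _ : NonZero p
    _ = prime⇒nonZero p-prime
    _ : NonZero (p ^ suc m)
    _ = primePower-nonZero p-prime (suc m)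
    _ : NonTrivial p
    _ = prime⇒nonTrivial p-prime
  n = p ^ suc m
  p∣n : p ∣ n
  p∣n = m∣m*n (p ^ m)
  open FiniteGroup (ℤₙ n) using (_∙_; _⁻¹)
  w = toℕ (x ⁻¹ ∙ y)
  go : (d : Dec (toℕ x % p ≡ toℕ y % p)) → (if does (gcd w n ℕₚ.≟ 1) then 1ℤ else 0ℤ) ≡ (if does d then 0ℤ else 1ℤ)
  go (yes x≡y) = if-no (gcd w n ℕₚ.≟ 1) λ gcd≡1 → ℕ.nonTrivial⇒≢1
    (∣1⇒≡1 (≡.subst (p ∣_) gcd≡1 (gcd-greatest (congruent⇒∣ p n p∣n x y x≡y) p∣n)))
  go (no x≢y)  = if-yes (gcd w n ℕₚ.≟ 1)
    (coprime⇒gcd≡1 (prime∤⇒coprime p-prime (x≢y ∘ ∣⇒congruent p n p∣n x y) (suc m)))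

corollary3p1 :
    ∀ (p m : ℕ) (p-prime : Prime p) (m≥1 : m ≥ 1) →
    let n = p ^ m
        instance
          n≢0 : NonZero n
          n≢0 = primePower-nonZero p-prime m
          n>1 : NonTrivial n
          n>1 = primePower-nonTrivial p-prime m≥1
        S = coprimeResidues n
        Γ = Cay (ℤₙ n) S
    in HasAdjacencySpectrum Γ
         ([ + n - + (p ^ (m ∸ 1)) ] ++ replicate (n ∸ p) (+ 0) ++ replicate (p ∸ 1) (- + (p ^ (m ∸ 1))))
-- With exponent `suc m` the power unfolds to p · p^m, so the required factorisation of n is `refl`.
-- The `NonTrivial` evidence is an irrelevant argument of `coprimeResidues`, so this graph and the
-- one in `adjacency-congruence` coincide although their evidence is built from different
-- inequalities.
corollary3p1 p (suc m) p-prime m≥1 =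
  residueClasses-spectrum p (p ^ m) (p ^ suc m) {{prime⇒nonZero p-prime}} {{primePower-nonZero p-prime (suc m)}}
    ≡.refl _ (adjacency-congruence m p-prime)
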